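{- There is a constant $\beta\ge 0$ such that the following holds. Let $P$ be a polyomino, let $c\ge0$ be the scan cost, and consider the MWPDV (milling variant) on $P$ with circular ($L_2$) visibility range of radius $r=1$ and tour length measured in the $L_1$-metric, where either no starting point is prescribed or the prescribed starting point is a grid point of $P$ (in the interior or on the boundary). Then there is a feasible solution $T$ that is $4$-competitive, i.e., $t(T)\le 4\cdot t(T^*)+\beta$, where $T^*$ is an optimal solution.
   Context: A polyomino is a connected axis-parallel polygon with integer coordinates, i.e. a connected union of unit grid squares (pixels); grid points are points with integer coordinates. In the Myopic Watchman Problem with Discrete Vision (MWPDV), a feasible solution is a closed tour $T$ together with a finite set ${\cal S}(T)$ of scan points on $T$ that covers $P$; its cost is $t(T)=c\cdot|{\cal S}(T)|+L(T)$, where $L(T)$ is the length of the tour. In the milling variant, tour, scan points and visibility must stay within $P$: a point $q\in P$ is seen from a scan point $p\in P$ if the segment $qp$ is contained in $P$ and $\|q-p\|_2\le r$; a set of scan points covers $P$ if every $q\in P$ is seen from at least one of them. The constant $\beta$ is absolute (independent of $P$ and $c$). -}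

module Defs where

open import Algebra.Bundles using (CommutativeRing)
import Algebra.Properties.Semiring.Mult as SemiringMult
open import Data.Integer.Base as ℤ using (ℤ; +_; -[1+_])
open import Data.List.Base using (List; []; _∷_; length; map)
open import Data.List.Membership.Propositional using (_∈_)
open import Data.List.Relation.Unary.All using (All)
open import Data.List.Relation.Unary.Any using (Any)
open import Data.List.Relation.Unary.Linked using (Linked)
import Data.List.Relation.Unary.Unique.Setoid as UniqueSetoid
open import Data.Maybe.Base using (Maybe; just; nothing)
open import Data.Nat.Base as ℕ using (ℕ; suc)
open import Data.Product.Base using (Σ; ∃; ∃-syntax; _×_; _,_; proj₁)
open import Data.Product.Relation.Binary.Pointwise.NonDependent using (×-setoid)
open import Data.Sum.Base using ([_,_]′)
open import Data.Unit.Base using (⊤)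
open import Function.Base using (const)
open import Level using (0ℓ)
open import Relation.Binary.Bundles using (Setoid)
open import Relation.Binary.Construct.Closure.ReflexiveTransitive using (Star)
open import Relation.Binary.Core using (Rel)
open import Relation.Binary.PropositionalEquality.Core using (_≡_; _≢_)
open import Relation.Binary.Structures using (IsDecTotalOrder)
open import Relation.Nullary.Negation.Core using (¬_)
open import Relation.Unary using (Pred; Satisfiable)

UpperBound : {A : Set} → Rel A 0ℓ → Pred A 0ℓ → Pred A 0ℓ
UpperBound _≤_ S u = ∀ {x} → S x → x ≤ u

LeastUpperBound : {A : Set} → Rel A 0ℓ → Pred A 0ℓ → Pred A 0ℓ
LeastUpperBound _≤_ S s =
  UpperBound _≤_ S s × (∀ {u} → UpperBound _≤_ S u → s ≤ u)

-- The axioms of the classical real numbers, which determine them up to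
-- isomorphism.  The order is decidable, as in classical analysis.
record CompleteOrderedField : Set₁ where
  field
    commutativeRing : CommutativeRing 0ℓ 0ℓ
  open CommutativeRing commutativeRing public

  infix 4 _≤_
  field
    _≤_             : Rel Carrier 0ℓ
    isDecTotalOrder : IsDecTotalOrder _≈_ _≤_
    +-monoʳ-≤       : ∀ x {y z} → y ≤ z → x + y ≤ x + z
    *-nonNegative   : ∀ {x y} → 0# ≤ x → 0# ≤ y → 0# ≤ x * y
    0≉1             : ¬ (0# ≈ 1#)
    inverse         : ∀ x → ¬ (x ≈ 0#) → ∃[ y ] x * y ≈ 1#
    supremum        : (S : Pred Carrier 0ℓ) → Satisfiable S →
                      ∃ (UpperBound _≤_ S) → ∃ (LeastUpperBound _≤_ S)

  open IsDecTotalOrder isDecTotalOrder public using (total)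

  infix 4 _<_
  _<_ : Rel Carrier 0ℓ
  x < y = (x ≤ y) × ¬ (x ≈ y)

  ∣_∣ : Carrier → Carrier
  ∣ x ∣ = [ const x , const (- x) ]′ (total 0# x)

  fromℕ : ℕ → Carrier
  fromℕ n = SemiringMult._×_ semiring n 1#

  fromℤ : ℤ → Carrier
  fromℤ (+ n)    = fromℕ n
  fromℤ -[1+ n ] = - fromℕ (suc n)

-- A pixel is represented by its lower left corner.
Pixel : Set
Pixel = ℤ × ℤ

EdgeAdjacent : Rel Pixel 0ℓ
EdgeAdjacent (i , j) (k , l) = ℤ.∣ i ℤ.- k ∣ ℕ.+ ℤ.∣ j ℤ.- l ∣ ≡ 1

-- Pixels touching only in a corner do not count as connected.  The list stands
-- for the set of its elements: order and repetitions are irrelevant.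
record Polyomino : Set where
  field
    pixels    : List Pixel
    nonempty  : pixels ≢ []
    connected : ∀ {a b} → a ∈ pixels → b ∈ pixels →
                Star (λ x y → y ∈ pixels × EdgeAdjacent x y) a b

open Polyomino public

module MWPDV (ℝ : CompleteOrderedField) where

  open CompleteOrderedField ℝ public

  pointSetoid : Setoid 0ℓ 0ℓ
  pointSetoid = ×-setoid setoid setoid

  open Setoid pointSetoid public using () renaming (Carrier to Point; _≈_ to _≈ₚ_)
  open UniqueSetoid pointSetoid public using (Unique)

  UnitInterval : Pred Carrier 0ℓ
  UnitInterval t = (0# ≤ t) × (t ≤ 1#)

  d₁ : Point → Point → Carrier
  d₁ (x , y) (x′ , y′) = ∣ x′ - x ∣ + ∣ y′ - y ∣

  -- ‖q - p‖₂ ≤ r, squared; meaningful for r ≥ 0.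
  WithinL₂ : Carrier → Rel Point 0ℓ
  WithinL₂ r (x , y) (x′ , y′) =
    (x′ - x) * (x′ - x) + (y′ - y) * (y′ - y) ≤ r * r

  convex : Carrier → Point → Point → Point
  convex s (x , y) (x′ , y′) =
    (1# - s) * x + s * x′ , (1# - s) * y + s * y′

  InPixel : Point → Pixel → Set
  InPixel (x , y) (i , j) =
    ((fromℤ i ≤ x) × (x ≤ fromℤ i + 1#)) × ((fromℤ j ≤ y) × (y ≤ fromℤ j + 1#))

  infix 4 _∈ᴾ_
  _∈ᴾ_ : Point → Polyomino → Set
  q ∈ᴾ P = Any (InPixel q) (pixels P)

  gridPoint : ℤ × ℤ → Point
  gridPoint (i , j) = fromℤ i , fromℤ j

  GridPointOf : Polyomino → Set
  GridPointOf P = Σ (ℤ × ℤ) λ g → gridPoint g ∈ᴾ P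

  Sees : Polyomino → Carrier → Rel Point 0ℓ
  Sees P r p q = (∀ s → UnitInterval s → convex s p q ∈ᴾ P) × WithinL₂ r p q

  polylineLength : List Point → Carrier
  polylineLength []           = 0#
  polylineLength (p ∷ [])     = 0#
  polylineLength (p ∷ q ∷ ps) = d₁ p q + polylineLength (q ∷ ps)

  Partition : List Carrier → Set
  Partition ts = Linked _≤_ ts × All UnitInterval ts

  InscribedLength : (Carrier → Point) → Pred Carrier 0ℓ
  InscribedLength γ v = ∃[ ts ] Partition ts × (v ≈ polylineLength (map γ ts))

  -- Uniform continuity on [0,1], i.e. continuity, by compactness.
  Continuous : (Carrier → Point) → Set
  Continuous γ =
    ∀ ε → 0# < ε → ∃[ δ ] (0# < δ) ×
      (∀ s t → UnitInterval s → UnitInterval t → ∣ t - s ∣ ≤ δ → d₁ (γ s) (γ t) ≤ ε)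

  -- A closed curve parametrised over [0,1] (values of the path elsewhere are
  -- irrelevant), rectifiable, with its length in the L₁-metric.
  record Tour : Set where
    field
      path        : Carrier → Point
      continuous  : Continuous path
      closed      : path 0# ≈ₚ path 1#
      tourLength  : Carrier
      isLength    : LeastUpperBound _≤_ (InscribedLength path) tourLength

  open Tour public

  infix 4 _OnTour_
  _OnTour_ : Point → Tour → Set
  p OnTour T = ∃[ t ] UnitInterval t × (path T t ≈ₚ p)

  record Solution : Set where
    field
      tour     : Tour
      scans    : List Point
      distinct : Unique scans
      onTour   : All (_OnTour tour) scans

  open Solution public

  cost : Carrier → Solution → Carrier
  cost c T = c * fromℕ (length (scans T)) + tourLength (tour T)

  StartsAt : ∀ {P} → Maybe (GridPointOf P) → Tour → Set
  StartsAt nothing  T = ⊤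
  StartsAt (just g) T = path T 0# ≈ₚ gridPoint (proj₁ g)

  -- Scan points need no separate containment condition: they lie on the tour.
  record Feasible (P : Polyomino) (r : Carrier) (start : Maybe (GridPointOf P))
                  (T : Solution) : Set where
    field
      inside : ∀ t → UnitInterval t → path (tour T) t ∈ᴾ P
      covers : ∀ q → q ∈ᴾ P → Any (λ p → Sees P r p q) (scans T)
      starts : StartsAt {P} start (tour T)

  Optimal : (P : Polyomino) (r c : Carrier) → Maybe (GridPointOf P) →
            Solution → Set
  Optimal P r c start T =
    Feasible P r start T × (∀ T′ → Feasible P r start T′ → cost c T ≤ cost c T′)

{-# OPTIONS --safe #-}

-- Let N be the number of pixels.  Walking along a spanning tree of the pixels
-- and scanning in every pixel centre costs N scans and length 2N + O(1).
-- Conversely, a scan point sees at most a square of area 4, so a solution with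
-- k scans has N ≤ 4k; and a square of side 2 moved along a path of L₁-length L
-- sweeps an area of at most 4 + 2L, so N ≤ 2L + O(1).  Areas are measured by
-- counting the points of a grid of mesh 1/M, with M large compared to N and k.
module Submission where

open import Defs
open import Algebra.Bundles using (AbelianGroup)
import Algebra.Properties.AbelianGroup as AbelianGroupProperties
import Algebra.Properties.Group as GroupProperties
import Algebra.Properties.Ring as RingProperties
import Algebra.Properties.Semiring.Mult as SemiringMult
import Algebra.Solver.Ring as RingSolver
open import Algebra.Solver.Ring.AlmostCommutativeRing
  using (fromCommutativeRing; _-Raw-AlmostCommutative⟶_)
open import Data.Fin.Base using (Fin; toℕ)
import Data.Fin.Properties as Fin
open import Data.Integer.Base as ℤ using (ℤ; +_; -[1+_])
import Data.Integer.Properties as ℤ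
import Data.Integer.Tactic.RingSolver as ℤ-Solver
open import Data.List.Base
  using (List; []; _∷_; _++_; length; map; upTo; allFin; cartesianProduct; cartesianProductWith;
         concatMap; deduplicate)
open import Data.List.Membership.Propositional using (_∈_; find; lose)
import Data.List.Membership.Propositional.Properties as ∈
import Data.List.Properties as List
open import Data.List.Relation.Binary.Permutation.Propositional using (↭-sym)
open import Data.List.Relation.Binary.Permutation.Propositional.Properties
  using (All-resp-↭; Any-resp-↭; ↭-length)
open import Data.List.Relation.Binary.Pointwise as Pointwise using (Pointwise; []; _∷_)
open import Data.List.Relation.Unary.All as All using (All; []; _∷_)
import Data.List.Relation.Unary.All.Properties as All
import Data.List.Relation.Unary.AllPairs as AllPairs
open import Data.List.Relation.Unary.Any as Any using (Any; here; there)
import Data.List.Relation.Unary.Any.Properties as Any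
open import Data.List.Relation.Unary.Linked using ([]; _∷_)
import Data.List.Relation.Unary.Unique.DecPropositional.Properties as UniqueDec
open import Data.List.Relation.Unary.Unique.Propositional using (Unique)
import Data.List.Relation.Unary.Unique.Propositional.Properties as Unique
import Data.List.Relation.Unary.Unique.Setoid.Properties as UniqueSetoid
import Data.List.Sort as Sort
open import Data.Maybe.Base as Maybe using (Maybe; just; nothing)
open import Data.Nat.Base as ℕ using (ℕ; zero; suc; z≤n; s≤s)
import Data.Nat.Properties as ℕ
import Data.Nat.Tactic.RingSolver as ℕ-Solver
open import Data.Product.Base using (_×_; _,_; proj₁; proj₂; ∃; ∃-syntax; Σ-syntax)
open import Data.Product.Properties using (≡-dec)
open import Data.Sum.Base using (_⊎_; inj₁; inj₂; [_,_]′)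
open import Data.Unit.Base using (tt)
open import Function.Base using (_∘_)
open import Relation.Binary.Bundles using (DecTotalOrder; Setoid)
open import Relation.Binary.Construct.Closure.ReflexiveTransitive using (Star; ε; _◅_)
open import Relation.Binary.Definitions using (DecidableEquality; tri<; tri≈; tri>)
open import Relation.Binary.PropositionalEquality as ≡ using (_≡_; _≢_)
open import Relation.Binary.Structures using (IsDecTotalOrder)
open import Relation.Nullary.Decidable.Core using (yes; no; dec⇒maybe)
open import Relation.Nullary.Negation.Core using (¬_; contradiction)

-- Counting the grid points covered by boxes

-- The two terms of the cost are compared separately, so one tour serves every `c`: the scan term
-- uses N ≤ 4k, and the length 2N + O(1) is compared with 4L + O(1) by doubling the second bound.
-- Each comparison loses a factor 4 on its own, and the scan cost carries no additive error, which
-- is why the additive constant does not depend on `c`. The obstacle is area, since the reals are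
-- given by axioms only. In place of measure, the grid points of pixels form a list without
-- repetitions that embeds in the list of grid points near the scan points, and lengths are
-- compared. Squares suit this better than discs: their coordinates separate, and an axis-parallel
-- square leaves behind an amount governed exactly by the L₁-distance it moves. The curve itself is
-- never discretised. Only the polygon through the scan points, in the order of their times, is
-- rounded; this keeps the number of rounding errors finite and known before the mesh is chosen.

private module ℤ-Group = GroupProperties (AbelianGroup.group ℤ.+-0-abelianGroup)

module _ {A : Set} where

  ∈-remove : ∀ (xs : List A) {x y zs} → y ∈ xs ++ x ∷ zs → y ≢ x → y ∈ xs ++ zs
  ∈-remove xs y∈ y≢x with ∈.∈-++⁻ xs y∈
  ... | inj₁ y∈xs          = ∈.∈-++⁺ˡ y∈xs
  ... | inj₂ (here y≡x)    = contradiction y≡x y≢x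
  ... | inj₂ (there y∈zs)  = ∈.∈-++⁺ʳ xs y∈zs

  -- The substitute for monotonicity of area: `ys` may list points repeatedly, so overlapping
  -- regions can simply be concatenated.
  Unique-length-≤ : ∀ {xs ys : List A} → Unique xs → (∀ {x} → x ∈ xs → x ∈ ys) →
                    length xs ℕ.≤ length ys
  Unique-length-≤ AllPairs.[] _ = z≤n
  Unique-length-≤ {x ∷ xs} (x∉xs AllPairs.∷ xs!) xs⊆ys with ∈.∈-∃++ (xs⊆ys (here ≡.refl))
  ... | as , bs , ≡.refl = begin
    suc (length xs)            ≤⟨ s≤s (Unique-length-≤ xs! λ y∈xs →
                                    ∈-remove as (xs⊆ys (there y∈xs)) λ y≡x →
                                    All.lookup x∉xs y∈xs (≡.sym y≡x)) ⟩
    suc (length (as ++ bs))    ≡⟨ List.length-++-sucʳ as x bs ⟨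
    length (as ++ x ∷ bs)      ∎
    where open ℕ.≤-Reasoning

length-cartesianProductWith : ∀ {A B C : Set} (f : A → B → C) xs ys →
  length (cartesianProductWith f xs ys) ≡ length xs ℕ.* length ys
length-cartesianProductWith f []       ys = ≡.refl
length-cartesianProductWith f (x ∷ xs) ys = begin
  length (map (f x) ys ++ cartesianProductWith f xs ys)
    ≡⟨ List.length-++ (map (f x) ys) ⟩
  length (map (f x) ys) ℕ.+ length (cartesianProductWith f xs ys)
    ≡⟨ ≡.cong₂ ℕ._+_ (List.length-map (f x) ys) (length-cartesianProductWith f xs ys) ⟩
  length ys ℕ.+ length xs ℕ.* length ys ∎
  where open ≡.≡-Reasoning

length-concatMap : ∀ {A B : Set} (f : A → List B) {n} → (∀ x → length (f x) ≡ n) →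
                   ∀ xs → length (concatMap f xs) ≡ length xs ℕ.* n
length-concatMap f f≡n []       = ≡.refl
length-concatMap f f≡n (x ∷ xs) =
  ≡.trans (List.length-++ (f x)) (≡.cong₂ ℕ._+_ (f≡n x) (length-concatMap f f≡n xs))

interval : ℤ → ℕ → List ℤ
interval a n = map (λ i → a ℤ.+ + i) (upTo n)

length-interval : ∀ a n → length (interval a n) ≡ n
length-interval a n = ≡.trans (List.length-map _ (upTo n)) (List.length-upTo n)

∈-interval : ∀ a n {b} → a ℤ.≤ b → b ℤ.< a ℤ.+ + n → b ∈ interval a n
∈-interval a n {b} a≤b b<a+n =
  ≡.subst (_∈ interval a n) b′≡b (∈.∈-map⁺ (λ i → a ℤ.+ + i) (∈.∈-upTo⁺ i<n))
  where
  i : ℕ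
  i = ℤ.∣ b ℤ.- a ∣
  +i≡ : + i ≡ b ℤ.- a
  +i≡ = ℤ.0≤i⇒+∣i∣≡i (ℤ.i≤j⇒0≤j-i a≤b)
  b′≡b : a ℤ.+ + i ≡ b
  b′≡b = ≡.trans (≡.cong (λ x → a ℤ.+ x) +i≡) (lemma a b)
    where
    lemma : ∀ a b → a ℤ.+ (b ℤ.- a) ≡ b
    lemma = ℤ-Solver.solve-∀
  i<n : i ℕ.< n
  i<n = ℕ.≰⇒> λ n≤i → ℤ.<⇒≱ (≡.subst (ℤ._< a ℤ.+ + n) (≡.sym b′≡b) b<a+n)
                                (ℤ.+-monoʳ-≤ a (ℤ.+≤+ n≤i))

module Boxes (M : ℕ) where

  infix 4 _≲_
  _≲_ : ℤ → ℤ → Set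
  a ≲ u = (u ℤ.- + M ℤ.≤ a) × (a ℤ.≤ u ℤ.+ + M)

  -- In coordinates scaled by `M` a pixel has side `M`, so this is the square of side 2 around a
  -- rounded scan point.
  InBox : ℤ × ℤ → ℤ × ℤ → Set
  InBox (u , v) (a , b) = (a ≲ u) × (b ≲ v)

  -- Both ends of the interval from `u - M` to `u + M` count; the extra 1 is the source of the
  -- errors treated in the arithmetic lemmas below.
  side : ℕ
  side = suc (M ℕ.+ M)

  range : ℤ → List ℤ
  range u = interval (u ℤ.- + M) side

  ∈-range : ∀ {a} u → a ≲ u → a ∈ range u
  ∈-range {a} u (l , h) = ∈-interval (u ℤ.- + M) side l (begin-strict
    a                                   ≤⟨ h ⟩
    u ℤ.+ + M                           ≡⟨ lemma u (+ M) ⟩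
    u ℤ.- + M ℤ.+ (+ M ℤ.+ + M)         <⟨ ℤ.+-monoʳ-< (u ℤ.- + M) (ℤ.+<+ (ℕ.n<1+n (M ℕ.+ M))) ⟩
    u ℤ.- + M ℤ.+ + side                ∎)
    where
    open ℤ.≤-Reasoning
    lemma : ∀ u m → u ℤ.+ m ≡ u ℤ.- m ℤ.+ (m ℤ.+ m)
    lemma = ℤ-Solver.solve-∀

  _≲?_ : ∀ a u → (a ≲ u) ⊎ (a ℤ.< u ℤ.- + M) ⊎ (u ℤ.+ + M ℤ.< a)
  a ≲? u with (u ℤ.- + M) ℤ.≤? a | a ℤ.≤? (u ℤ.+ + M)
  ... | yes l | yes h = inj₁ (l , h)
  ... | no l  | _     = inj₂ (inj₁ (ℤ.≰⇒> l))
  ... | _     | no h  = inj₂ (inj₂ (ℤ.≰⇒> h))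

  -- The coordinates that an interval of radius `M` loses when its centre moves from `u` to `u′`.
  -- For moves longer than `side` the list also contains numbers outside the original interval, so
  -- that its length is always exactly the distance moved.
  leaving : ℤ → ℤ → List ℤ
  leaving u u′ with ℤ.≤-total u u′
  ... | inj₁ _ = interval (u ℤ.- + M) ℤ.∣ u′ ℤ.- u ∣
  ... | inj₂ _ = interval (ℤ.suc (u′ ℤ.+ + M)) ℤ.∣ u′ ℤ.- u ∣

  length-leaving : ∀ u u′ → length (leaving u u′) ≡ ℤ.∣ u′ ℤ.- u ∣
  length-leaving u u′ with ℤ.≤-total u u′
  ... | inj₁ _ = length-interval (u ℤ.- + M) _
  ... | inj₂ _ = length-interval (ℤ.suc (u′ ℤ.+ + M)) _

  ∈-leaving : ∀ {a} u u′ → a ≲ u → (a ≲ u′) ⊎ (a ∈ leaving u u′)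
  ∈-leaving {a} u u′ (l , h) with ℤ.≤-total u u′ | a ≲? u′
  ... | _       | inj₁ a≲u′ = inj₁ a≲u′
  ... | inj₁ u≤u′ | inj₂ (inj₁ below) = inj₂ (∈-interval (u ℤ.- + M) ℤ.∣ u′ ℤ.- u ∣ l (begin-strict
    a                                      <⟨ below ⟩
    u′ ℤ.- + M                             ≡⟨ lemma u u′ (+ M) ⟩
    u ℤ.- + M ℤ.+ (u′ ℤ.- u)               ≡⟨ ≡.cong (λ x → u ℤ.- + M ℤ.+ x) (ℤ.0≤i⇒+∣i∣≡i (ℤ.i≤j⇒0≤j-i u≤u′)) ⟨
    u ℤ.- + M ℤ.+ + ℤ.∣ u′ ℤ.- u ∣         ∎))
    where
    open ℤ.≤-Reasoning
    lemma : ∀ u u′ m → u′ ℤ.- m ≡ u ℤ.- m ℤ.+ (u′ ℤ.- u)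
    lemma = ℤ-Solver.solve-∀
  ... | inj₁ u≤u′ | inj₂ (inj₂ above) =
    contradiction (ℤ.≤-trans h (ℤ.+-monoˡ-≤ (+ M) u≤u′)) (ℤ.<⇒≱ above)
  ... | inj₂ u′≤u | inj₂ (inj₁ below) =
    contradiction (ℤ.≤-trans (ℤ.+-monoˡ-≤ (ℤ.- + M) u′≤u) l) (ℤ.<⇒≱ below)
  ... | inj₂ u′≤u | inj₂ (inj₂ above) = inj₂ (∈-interval (ℤ.suc (u′ ℤ.+ + M)) ℤ.∣ u′ ℤ.- u ∣ (ℤ.i<j⇒suc[i]≤j above) (begin-strict
    a                                              ≤⟨ h ⟩
    u ℤ.+ + M                                      <⟨ ℤ.suc[i]≤j⇒i<j ℤ.≤-refl ⟩
    ℤ.suc (u ℤ.+ + M)                              ≡⟨ lemma u u′ (+ M) ⟩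
    ℤ.suc (u′ ℤ.+ + M) ℤ.+ (u ℤ.- u′)              ≡⟨ ≡.cong (λ x → ℤ.suc (u′ ℤ.+ + M) ℤ.+ x) (ℤ.∣-∣-≤ u′≤u) ⟨
    ℤ.suc (u′ ℤ.+ + M) ℤ.+ + ℤ.∣ u′ ℤ.- u ∣        ∎))
    where
    open ℤ.≤-Reasoning
    lemma : ∀ u u′ m → (+ 1) ℤ.+ (u ℤ.+ m) ≡ (+ 1) ℤ.+ (u′ ℤ.+ m) ℤ.+ (u ℤ.- u′)
    lemma = ℤ-Solver.solve-∀

  box : ℤ × ℤ → List (ℤ × ℤ)
  box (u , v) = cartesianProduct (range u) (range v)

  length-box : ∀ z → length (box z) ≡ side ℕ.* side
  length-box (u , v) = ≡.trans (length-cartesianProductWith _,_ (range u) (range v))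
    (≡.cong₂ ℕ._*_ (length-interval (u ℤ.- + M) side) (length-interval (v ℤ.- + M) side))

  ∈-box : ∀ {a} z → InBox z a → a ∈ box z
  ∈-box (u , v) (a≲u , b≲v) = ∈.∈-cartesianProduct⁺ (∈-range u a≲u) (∈-range v b≲v)

  gridDistance : ℤ × ℤ → ℤ × ℤ → ℕ
  gridDistance (u , v) (u′ , v′) = ℤ.∣ u′ ℤ.- u ∣ ℕ.+ ℤ.∣ v′ ℤ.- v ∣

  -- What the box at `z` has and the box at `z′` lacks is L-shaped. The two rectangles covering it
  -- overlap at the corner; counting the overlap twice makes the size linear in the L₁-distance.
  strip : ℤ × ℤ → ℤ × ℤ → List (ℤ × ℤ)
  strip (u , v) (u′ , v′) =
    cartesianProduct (leaving u u′) (range v) ++ cartesianProduct (range u) (leaving v v′)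

  length-strip : ∀ z z′ → length (strip z z′) ≡ side ℕ.* gridDistance z z′
  length-strip (u , v) (u′ , v′) = begin
    length (strip (u , v) (u′ , v′))
      ≡⟨ List.length-++ (cartesianProduct (leaving u u′) (range v)) ⟩
    length (cartesianProduct (leaving u u′) (range v)) ℕ.+
    length (cartesianProduct (range u) (leaving v v′))
      ≡⟨ ≡.cong₂ ℕ._+_ (length-cartesianProductWith _,_ (leaving u u′) (range v))
                     (length-cartesianProductWith _,_ (range u) (leaving v v′)) ⟩
    length (leaving u u′) ℕ.* length (range v) ℕ.+ length (range u) ℕ.* length (leaving v v′)
      ≡⟨ ≡.cong₂ ℕ._+_ (≡.cong₂ ℕ._*_ (length-leaving u u′) (length-interval (v ℤ.- + M) side))
                     (≡.cong₂ ℕ._*_ (length-interval (u ℤ.- + M) side) (length-leaving v v′)) ⟩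
    ℤ.∣ u′ ℤ.- u ∣ ℕ.* side ℕ.+ side ℕ.* ℤ.∣ v′ ℤ.- v ∣
      ≡⟨ lemma ℤ.∣ u′ ℤ.- u ∣ ℤ.∣ v′ ℤ.- v ∣ side ⟩
    side ℕ.* gridDistance (u , v) (u′ , v′) ∎
    where
    open ≡.≡-Reasoning
    lemma : ∀ x y s → x ℕ.* s ℕ.+ s ℕ.* y ≡ s ℕ.* (x ℕ.+ y)
    lemma = ℕ-Solver.solve-∀

  ∈-strip : ∀ {a} z z′ → InBox z a → InBox z′ a ⊎ (a ∈ strip z z′)
  ∈-strip (u , v) (u′ , v′) (a≲u , b≲v) with ∈-leaving u u′ a≲u | ∈-leaving v v′ b≲v
  ... | inj₁ a≲u′ | inj₁ b≲v′ = inj₁ (a≲u′ , b≲v′)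
  ... | inj₂ a∈   | _         = inj₂ (∈.∈-++⁺ˡ (∈.∈-cartesianProduct⁺ a∈ (∈-range v b≲v)))
  ... | inj₁ _    | inj₂ b∈   =
    inj₂ (∈.∈-++⁺ʳ (cartesianProduct (leaving u u′) (range v)) (∈.∈-cartesianProduct⁺ (∈-range u a≲u) b∈))

  gridLength : List (ℤ × ℤ) → ℕ
  gridLength []            = 0
  gridLength (z ∷ [])      = 0
  gridLength (z ∷ z′ ∷ zs) = gridDistance z z′ ℕ.+ gridLength (z′ ∷ zs)

  -- A point of the union is charged to a move at which the sliding box leaves it, and a point that
  -- is never left again to the last box, the only one listed in full.
  sweep : List (ℤ × ℤ) → List (ℤ × ℤ)
  sweep []            = []
  sweep (z ∷ [])      = box z
  sweep (z ∷ z′ ∷ zs) = strip z z′ ++ sweep (z′ ∷ zs)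

  length-sweep : ∀ z zs → length (sweep (z ∷ zs)) ≡ side ℕ.* gridLength (z ∷ zs) ℕ.+ side ℕ.* side
  length-sweep z []        = ≡.trans (length-box z) (≡.cong (ℕ._+ side ℕ.* side) (≡.sym (ℕ.*-zeroʳ side)))
  length-sweep z (z′ ∷ zs) = begin
    length (strip z z′ ++ sweep (z′ ∷ zs))
      ≡⟨ List.length-++ (strip z z′) ⟩
    length (strip z z′) ℕ.+ length (sweep (z′ ∷ zs))
      ≡⟨ ≡.cong₂ ℕ._+_ (length-strip z z′) (length-sweep z′ zs) ⟩
    side ℕ.* gridDistance z z′ ℕ.+ (side ℕ.* gridLength (z′ ∷ zs) ℕ.+ side ℕ.* side)
      ≡⟨ lemma side (gridDistance z z′) (gridLength (z′ ∷ zs)) ⟩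
    side ℕ.* gridLength (z ∷ z′ ∷ zs) ℕ.+ side ℕ.* side ∎
    where
    open ≡.≡-Reasoning
    lemma : ∀ s d l → s ℕ.* d ℕ.+ (s ℕ.* l ℕ.+ s ℕ.* s) ≡ s ℕ.* (d ℕ.+ l) ℕ.+ s ℕ.* s
    lemma = ℕ-Solver.solve-∀

  ∈-sweep : ∀ {a} zs → Any (λ z → InBox z a) zs → a ∈ sweep zs
  ∈-sweep (z ∷ [])      (here a∈z)  = ∈-box z a∈z
  ∈-sweep (z ∷ z′ ∷ zs) (there a∈)  = ∈.∈-++⁺ʳ (strip z z′) (∈-sweep (z′ ∷ zs) a∈)
  ∈-sweep (z ∷ z′ ∷ zs) (here a∈z)  =
    [ (λ a∈z′ → ∈.∈-++⁺ʳ (strip z z′) (∈-sweep (z′ ∷ zs) (here a∈z′))) , ∈.∈-++⁺ˡ ]′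
      (∈-strip z z′ a∈z)

  -- Offsets stop before `M`, so a pixel owns only its left and lower sides. Neighbouring pixels
  -- then share no grid point, and each contributes exactly `M * M` of them.
  cell : ℤ × ℤ → Fin M × Fin M → ℤ × ℤ
  cell (i , j) (p , q) = i ℤ.* + M ℤ.+ + toℕ p , j ℤ.* + M ℤ.+ + toℕ q

  private
    quotient-≮ : ∀ {i k : ℤ} (p q : Fin M) → i ℤ.* + M ℤ.+ + toℕ p ≡ k ℤ.* + M ℤ.+ + toℕ q → ¬ i ℤ.< k
    quotient-≮ {i} {k} p q eq i<k = ℤ.<-irrefl eq (begin-strict
      i ℤ.* + M ℤ.+ + toℕ p   <⟨ ℤ.+-monoʳ-< (i ℤ.* + M) (ℤ.+<+ (Fin.toℕ<n p)) ⟩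
      i ℤ.* + M ℤ.+ + M       ≡⟨ lemma i (+ M) ⟩
      ℤ.suc i ℤ.* + M         ≤⟨ ℤ.*-monoʳ-≤-nonNeg (+ M) (ℤ.i<j⇒suc[i]≤j i<k) ⟩
      k ℤ.* + M               ≤⟨ ℤ.i≤i+j (k ℤ.* + M) (+ toℕ q) ⟩
      k ℤ.* + M ℤ.+ + toℕ q   ∎)
      where
      open ℤ.≤-Reasoning
      lemma : ∀ i m → i ℤ.* m ℤ.+ m ≡ ((+ 1) ℤ.+ i) ℤ.* m
      lemma = ℤ-Solver.solve-∀

  divMod-injective : ∀ {i k : ℤ} {p q : Fin M} → i ℤ.* + M ℤ.+ + toℕ p ≡ k ℤ.* + M ℤ.+ + toℕ q →
                     i ≡ k × p ≡ q
  divMod-injective {i} {k} {p} {q} eq with ℤ.<-cmp i k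
  ... | tri< i<k _ _ = contradiction i<k (quotient-≮ p q eq)
  ... | tri> _ _ k<i = contradiction k<i (quotient-≮ q p (≡.sym eq))
  ... | tri≈ _ ≡.refl _ =
    ≡.refl , Fin.toℕ-injective (ℤ.+-injective (ℤ-Group.∙-cancelˡ (i ℤ.* + M) _ _ eq))

  cell-injective : ∀ {w x y z} → cell w y ≡ cell x z → w ≡ x × y ≡ z
  cell-injective {i , j} {k , l} {p , q} {p′ , q′} eq
    with divMod-injective {i} {k} {p} {p′} (≡.cong proj₁ eq) | divMod-injective {j} {l} {q} {q′} (≡.cong proj₂ eq)
  ... | ≡.refl , ≡.refl | ≡.refl , ≡.refl = ≡.refl , ≡.refl

  cells : List (ℤ × ℤ) → List (ℤ × ℤ)
  cells ps = cartesianProductWith cell ps (cartesianProduct (allFin M) (allFin M))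

  length-cells : ∀ ps → length (cells ps) ≡ length ps ℕ.* (M ℕ.* M)
  length-cells ps = begin
    length (cells ps)
      ≡⟨ length-cartesianProductWith cell ps _ ⟩
    length ps ℕ.* length (cartesianProduct (allFin M) (allFin M))
      ≡⟨ ≡.cong (length ps ℕ.*_) (length-cartesianProductWith _,_ (allFin M) (allFin M)) ⟩
    length ps ℕ.* (length (allFin M) ℕ.* length (allFin M))
      ≡⟨ ≡.cong (λ m → length ps ℕ.* (m ℕ.* m)) (List.length-tabulate (λ (i : Fin M) → i)) ⟩
    length ps ℕ.* (M ℕ.* M) ∎
    where open ≡.≡-Reasoning

  cells-unique : ∀ {ps} → Unique ps → Unique (cells ps)
  cells-unique ps! = Unique.cartesianProductWith⁺ cell cell-injective ps!
    (Unique.cartesianProduct⁺ (Unique.allFin⁺ M) (Unique.allFin⁺ M))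

  Covers : List (ℤ × ℤ) → List (ℤ × ℤ) → Set
  Covers zs ps = ∀ {p} → p ∈ ps → ∀ o → Any (λ z → InBox z (cell p o)) zs

  private
    covered : ∀ {zs ps} → Covers zs ps → ∀ {a} → a ∈ cells ps → Any (λ z → InBox z a) zs
    covered {zs} {ps} cov a∈ with ∈.∈-cartesianProductWith⁻ cell ps _ a∈
    ... | p , o , p∈ps , _ , ≡.refl = cov p∈ps o

  length-covered-≤-boxes : ∀ {ps zs} → Unique ps → Covers zs ps →
    length ps ℕ.* (M ℕ.* M) ℕ.≤ length zs ℕ.* (side ℕ.* side)
  length-covered-≤-boxes {ps} {zs} ps! cov = begin
    length ps ℕ.* (M ℕ.* M)         ≡⟨ length-cells ps ⟨
    length (cells ps)               ≤⟨ Unique-length-≤ (cells-unique ps!) (λ a∈ →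
                                         ∈.∈-concatMap⁺ box (Any.map (λ {z} → ∈-box z) (covered cov a∈))) ⟩
    length (concatMap box zs)       ≡⟨ length-concatMap box length-box zs ⟩
    length zs ℕ.* (side ℕ.* side)   ∎
    where open ℕ.≤-Reasoning

  -- Since `gridLength` is about M times the length L of the polygon, division by `M * M` turns this
  -- into N ≤ 2L + 4 up to rounding.
  length-covered-≤-sweep : ∀ {ps z zs} → Unique ps → Covers (z ∷ zs) ps →
    length ps ℕ.* (M ℕ.* M) ℕ.≤ side ℕ.* gridLength (z ∷ zs) ℕ.+ side ℕ.* side
  length-covered-≤-sweep {ps} {z} {zs} ps! cov = begin
    length ps ℕ.* (M ℕ.* M)         ≡⟨ length-cells ps ⟨
    length (cells ps)               ≤⟨ Unique-length-≤ (cells-unique ps!) (∈-sweep (z ∷ zs) ∘ covered cov) ⟩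
    length (sweep (z ∷ zs))         ≡⟨ length-sweep z zs ⟩
    side ℕ.* gridLength (z ∷ zs) ℕ.+ side ℕ.* side ∎
    where open ℕ.≤-Reasoning

-- Ordered fields

module OrderedField (ℝ : CompleteOrderedField) where

  open CompleteOrderedField ℝ
  open SemiringMult semiring using (×-homo-+; ×1-homo-*)
  open RingProperties ring using (-0#≈0#; -‿involutive; -‿distribˡ-*; -‿distribʳ-*)
  open AbelianGroupProperties +-abelianGroup using (⁻¹-∙-comm)
  import Relation.Binary.Reasoning.Setoid setoid as ≈-Reasoning

  decTotalOrder : DecTotalOrder _ _ _
  decTotalOrder = record { isDecTotalOrder = isDecTotalOrder }

  open IsDecTotalOrder isDecTotalOrder public using (_≤?_; antisym; ≤-respˡ-≈; ≤-respʳ-≈)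
    renaming (refl to ≤-refl; reflexive to ≤-reflexive; trans to ≤-trans)

  fromℤ-⊖ : ∀ m n → fromℤ (m ℤ.⊖ n) ≈ fromℕ m - fromℕ n
  fromℤ-⊖ zero    zero    = sym (-‿inverseʳ 0#)
  fromℤ-⊖ zero    (suc n) = sym (+-identityˡ _)
  fromℤ-⊖ (suc m) zero    = sym (trans (+-congˡ -0#≈0#) (+-identityʳ _))
  fromℤ-⊖ (suc m) (suc n) = begin
    fromℤ (suc m ℤ.⊖ suc n)                     ≡⟨ ≡.cong fromℤ (ℤ.[1+m]⊖[1+n]≡m⊖n m n) ⟩
    fromℤ (m ℤ.⊖ n)                             ≈⟨ fromℤ-⊖ m n ⟩
    fromℕ m - fromℕ n                           ≈⟨ +-congʳ (+-identityʳ _) ⟨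
    fromℕ m + 0# - fromℕ n                      ≈⟨ +-congʳ (+-congˡ (-‿inverseʳ 1#)) ⟨
    fromℕ m + (1# - 1#) - fromℕ n               ≈⟨ +-congʳ (+-assoc _ _ _) ⟨
    fromℕ m + 1# - 1# - fromℕ n                 ≈⟨ +-assoc _ _ _ ⟩
    fromℕ m + 1# + (- 1# - fromℕ n)             ≈⟨ +-cong (+-comm _ _) (⁻¹-∙-comm _ _) ⟩
    fromℕ (suc m) - fromℕ (suc n)               ∎
    where open ≈-Reasoning

  fromℤ-neg : ∀ i → fromℤ (ℤ.- i) ≈ - fromℤ i
  fromℤ-neg (+ zero)  = sym -0#≈0#
  fromℤ-neg (+ suc n) = refl
  fromℤ-neg -[1+ n ]  = sym (-‿involutive _)

  fromℤ-+ : ∀ i j → fromℤ (i ℤ.+ j) ≈ fromℤ i + fromℤ j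
  fromℤ-+ (+ m)    (+ n)    = ×-homo-+ 1# m n
  fromℤ-+ (+ m)    -[1+ n ] = fromℤ-⊖ m (suc n)
  fromℤ-+ -[1+ m ] (+ n)    = trans (fromℤ-⊖ n (suc m)) (+-comm _ _)
  fromℤ-+ -[1+ m ] -[1+ n ] = begin
    - fromℕ (suc (suc (m ℕ.+ n)))         ≡⟨ ≡.cong (λ k → - fromℕ (suc k)) (ℕ.+-suc m n) ⟨
    - fromℕ (suc m ℕ.+ suc n)             ≈⟨ -‿cong (×-homo-+ 1# (suc m) (suc n)) ⟩
    - (fromℕ (suc m) + fromℕ (suc n))     ≈⟨ ⁻¹-∙-comm _ _ ⟨
    - fromℕ (suc m) - fromℕ (suc n)       ∎
    where open ≈-Reasoning

  fromℤ-*ℕ : ∀ i n → fromℤ (i ℤ.* + n) ≈ fromℤ i * fromℕ n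
  fromℤ-*ℕ (+ m) n = begin
    fromℤ (+ m ℤ.* + n)    ≡⟨ ≡.cong fromℤ (ℤ.pos-* m n) ⟨
    fromℕ (m ℕ.* n)        ≈⟨ ×1-homo-* m n ⟩
    fromℕ m * fromℕ n      ∎
    where open ≈-Reasoning
  fromℤ-*ℕ -[1+ m ] n = begin
    fromℤ (-[1+ m ] ℤ.* + n)             ≡⟨ ≡.cong fromℤ (ℤ.neg-distribˡ-* (+ suc m) (+ n)) ⟨
    fromℤ (ℤ.- (+ suc m ℤ.* + n))        ≈⟨ fromℤ-neg (+ suc m ℤ.* + n) ⟩
    - fromℤ (+ suc m ℤ.* + n)            ≈⟨ -‿cong (fromℤ-*ℕ (+ suc m) n) ⟩
    - (fromℕ (suc m) * fromℕ n)          ≈⟨ -‿distribˡ-* _ _ ⟩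
    - fromℕ (suc m) * fromℕ n            ∎
    where open ≈-Reasoning

  fromℤ-* : ∀ i j → fromℤ (i ℤ.* j) ≈ fromℤ i * fromℤ j
  fromℤ-* i (+ n)    = fromℤ-*ℕ i n
  fromℤ-* i -[1+ n ] = begin
    fromℤ (i ℤ.* -[1+ n ])               ≡⟨ ≡.cong fromℤ (ℤ.neg-distribʳ-* i (+ suc n)) ⟨
    fromℤ (ℤ.- (i ℤ.* + suc n))          ≈⟨ fromℤ-neg (i ℤ.* + suc n) ⟩
    - fromℤ (i ℤ.* + suc n)              ≈⟨ -‿cong (fromℤ-*ℕ i (suc n)) ⟩
    - (fromℤ i * fromℕ (suc n))          ≈⟨ -‿distribʳ-* _ _ ⟩
    fromℤ i * - fromℕ (suc n)            ∎
    where open ≈-Reasoning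

  -- fromℤ (+ 1) is 1# + 0#; the coefficient 1 of the solver has to be 1# itself.
  coefficient : ℤ → Carrier
  coefficient (+ 1) = 1#
  coefficient i     = fromℤ i

  coefficient≈fromℤ : ∀ i → coefficient i ≈ fromℤ i
  coefficient≈fromℤ (+ 0)           = refl
  coefficient≈fromℤ (+ 1)           = sym (+-identityʳ 1#)
  coefficient≈fromℤ (+ suc (suc n)) = refl
  coefficient≈fromℤ -[1+ n ]        = refl

  -- Integer coefficients let the solver compute with numerals. From 2 on, `con (+ n)` denotes
  -- `fromℕ n` literally, so constants such as `fromℕ 14` and `fromℕ 31` match without conversion.
  coefficients : ℤ.+-*-rawRing -Raw-AlmostCommutative⟶ fromCommutativeRing commutativeRing
  coefficients = record
    { ⟦_⟧    = coefficient
    ; +-homo = λ i j → via (i ℤ.+ j) (fromℤ-+ i j) (+-cong (back i) (back j))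
    ; *-homo = λ i j → via (i ℤ.* j) (fromℤ-* i j) (*-cong (back i) (back j))
    ; -‿homo = λ i → via (ℤ.- i) (fromℤ-neg i) (-‿cong (back i))
    ; 0-homo = refl
    ; 1-homo = refl
    }
    where
    back : ∀ i → fromℤ i ≈ coefficient i
    back i = sym (coefficient≈fromℤ i)
    via : ∀ i {x y} → fromℤ i ≈ x → x ≈ y → coefficient i ≈ y
    via i p q = trans (coefficient≈fromℤ i) (trans p q)

  coefficient-≟ : ∀ i j → Maybe (coefficient i ≈ coefficient j)
  coefficient-≟ i j = Maybe.map (λ i≡j → reflexive (≡.cong coefficient i≡j)) (dec⇒maybe (i ℤ.≟ j))

  module Solver =
    RingSolver ℤ.+-*-rawRing (fromCommutativeRing commutativeRing) coefficients coefficient-≟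
  open Solver using (solve; con; _:=_; _:+_; _:*_; _:-_; :-_)

  +-mono-≤ : ∀ {w x y z} → w ≤ x → y ≤ z → w + y ≤ x + z
  +-mono-≤ {w} {x} {y} {z} w≤x y≤z = ≤-trans (+-monoʳ-≤ w y≤z)
    (≤-respˡ-≈ (+-comm z w) (≤-respʳ-≈ (+-comm z x) (+-monoʳ-≤ z w≤x)))

  ≤⇒0≤- : ∀ {x y} → x ≤ y → 0# ≤ y - x
  ≤⇒0≤- {x} {y} x≤y = ≤-respˡ-≈ (-‿inverseʳ x) (+-mono-≤ x≤y ≤-refl)

  infixl 6 _⊕_
  _⊕_ : ∀ {x y} → 0# ≤ x → 0# ≤ y → 0# ≤ x + y
  p ⊕ q = ≤-respˡ-≈ (+-identityˡ 0#) (+-mono-≤ p q)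

  infixl 7 _⊗_
  _⊗_ : ∀ {x y} → 0# ≤ x → 0# ≤ y → 0# ≤ x * y
  _⊗_ = *-nonNegative

  -- Linear arithmetic: x ≤ y follows once y - x is a nonnegative combination
  -- of nonnegative quantities, which the ring solver verifies.
  by-difference : ∀ {d x y} → 0# ≤ d → d ≈ y - x → x ≤ y
  by-difference {d} {x} {y} 0≤d d≈ =
    ≤-respˡ-≈ (+-identityʳ x) (≤-respʳ-≈ x+d≈y (+-monoʳ-≤ x 0≤d))
    where
    x+d≈y : x + d ≈ y
    x+d≈y = trans (+-congˡ d≈) (solve 2 (λ x y → x :+ (y :- x) := y) refl x y)

  0≤x² : ∀ x → 0# ≤ x * x
  0≤x² x with total 0# x
  ... | inj₁ 0≤x = 0≤x ⊗ 0≤x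
  ... | inj₂ x≤0 = ≤-respʳ-≈ (solve 1 (λ x → (con (+ 0) :- x) :* (con (+ 0) :- x) := x :* x) refl x)
                              (≤⇒0≤- x≤0 ⊗ ≤⇒0≤- x≤0)

  0≤1 : 0# ≤ 1#
  0≤1 = ≤-respʳ-≈ (*-identityˡ 1#) (0≤x² 1#)

  1≰0 : ¬ 1# ≤ 0#
  1≰0 1≤0 = 0≉1 (antisym 0≤1 1≤0)

  0≤fromℕ : ∀ n → 0# ≤ fromℕ n
  0≤fromℕ zero    = ≤-refl
  0≤fromℕ (suc n) = 0≤1 ⊕ 0≤fromℕ n

  fromℤ-mono-≤ : ∀ {i j} → i ℤ.≤ j → fromℤ i ≤ fromℤ j
  fromℤ-mono-≤ {i} {j} i≤j = by-difference (0≤fromℕ ℤ.∣ j ℤ.- i ∣) (begin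
    fromℤ (+ ℤ.∣ j ℤ.- i ∣)    ≡⟨ ≡.cong fromℤ (ℤ.0≤i⇒+∣i∣≡i (ℤ.i≤j⇒0≤j-i i≤j)) ⟩
    fromℤ (j ℤ.- i)            ≈⟨ fromℤ-+ j (ℤ.- i) ⟩
    fromℤ j + fromℤ (ℤ.- i)    ≈⟨ +-congˡ (fromℤ-neg i) ⟩
    fromℤ j - fromℤ i          ∎)
    where open ≈-Reasoning

  fromℤ-suc : ∀ i → fromℤ (ℤ.suc i) ≈ fromℤ i + 1#
  fromℤ-suc i = trans (fromℤ-+ (+ 1) i) (solve 1 (λ x → con (+ 1) :+ con (+ 0) :+ x := x :+ con (+ 1)) refl (fromℤ i))

  fromℤ-cancel-≤ : ∀ {i j} → fromℤ i ≤ fromℤ j → i ℤ.≤ j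
  fromℤ-cancel-≤ {i} {j} i≤j = ℤ.≮⇒≥ λ j<i → 1≰0 (by-difference
    (≤⇒0≤- (≤-trans (fromℤ-mono-≤ (ℤ.i<j⇒suc[i]≤j j<i)) i≤j) )
    (trans (+-congˡ (-‿cong (fromℤ-suc j)))
      (solve 1 (λ x → x :- (x :+ con (+ 1)) := con (+ 0) :- con (+ 1)) refl (fromℤ j))))

  fromℤ-injective : ∀ {i j} → fromℤ i ≈ fromℤ j → i ≡ j
  fromℤ-injective i≈j = ℤ.≤-antisym (fromℤ-cancel-≤ (≤-reflexive i≈j)) (fromℤ-cancel-≤ (≤-reflexive (sym i≈j)))

  fromℕ-+ : ∀ m n → fromℕ (m ℕ.+ n) ≈ fromℕ m + fromℕ n
  fromℕ-+ = ×-homo-+ 1#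

  fromℕ-* : ∀ m n → fromℕ (m ℕ.* n) ≈ fromℕ m * fromℕ n
  fromℕ-* = ×1-homo-*

  fromℕ-mono-≤ : ∀ {m n} → m ℕ.≤ n → fromℕ m ≤ fromℕ n
  fromℕ-mono-≤ m≤n = fromℤ-mono-≤ (ℤ.+≤+ m≤n)

  fromℕ-inverse : ∀ n → ∃[ w ] (0# ≤ w) × (fromℕ (suc n) * w ≈ 1#)
  fromℕ-inverse n = let w , mw≈1 = inverse m m≉0 in w , 0≤w mw≈1 , mw≈1
    where
    m : Carrier
    m = fromℕ (suc n)
    m≉0 : ¬ m ≈ 0#
    m≉0 m≈0 = 1≰0 (by-difference (0≤fromℕ n ⊕ ≤⇒0≤- (≤-reflexive m≈0))
      (solve 1 (λ x → x :+ (con (+ 0) :- (con (+ 1) :+ x)) := con (+ 0) :- con (+ 1)) refl (fromℕ n)))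
    0≤w : ∀ {w} → m * w ≈ 1# → 0# ≤ w
    0≤w {w} mw≈1 with total 0# w
    ... | inj₁ 0≤w = 0≤w
    ... | inj₂ w≤0 = contradiction (by-difference (0≤fromℕ (suc n) ⊗ ≤⇒0≤- w≤0)
      (trans (solve 2 (λ m w → m :* (con (+ 0) :- w) := con (+ 0) :- m :* w) refl m w) (+-congˡ (-‿cong mw≈1)))) 1≰0

  fromℕ-*-cancel-≤ : ∀ n {x y} → fromℕ (suc n) * x ≤ fromℕ (suc n) * y → x ≤ y
  fromℕ-*-cancel-≤ n {x} {y} mx≤my = let w , 0≤w , mw≈1 = fromℕ-inverse n in
    by-difference (0≤w ⊗ ≤⇒0≤- mx≤my) (begin
      w * (m * y - m * x)    ≈⟨ solve 4 (λ w m x y → w :* (m :* y :- m :* x) := m :* w :* (y :- x)) refl w m x y ⟩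
      m * w * (y - x)        ≈⟨ *-congʳ mw≈1 ⟩
      1# * (y - x)           ≈⟨ *-identityˡ _ ⟩
      y - x                  ∎)
    where
    m : Carrier
    m = fromℕ (suc n)
    open ≈-Reasoning

  x≤∣x∣ : ∀ x → x ≤ ∣ x ∣
  x≤∣x∣ x with total 0# x
  ... | inj₁ _   = ≤-refl
  ... | inj₂ x≤0 = by-difference (≤⇒0≤- x≤0 ⊕ ≤⇒0≤- x≤0)
    (solve 1 (λ x → (con (+ 0) :- x) :+ (con (+ 0) :- x) := :- x :- x) refl x)

  -x≤∣x∣ : ∀ x → - x ≤ ∣ x ∣
  -x≤∣x∣ x with total 0# x
  ... | inj₁ 0≤x = by-difference (0≤x ⊕ 0≤x) (solve 1 (λ x → x :+ x := x :- (:- x)) refl x)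
  ... | inj₂ _   = ≤-refl

  ∣x∣≤ : ∀ {x y} → x ≤ y → - x ≤ y → ∣ x ∣ ≤ y
  ∣x∣≤ {x} x≤y -x≤y with total 0# x
  ... | inj₁ _ = x≤y
  ... | inj₂ _ = -x≤y

  0≤∣x∣ : ∀ x → 0# ≤ ∣ x ∣
  0≤∣x∣ x with total 0# x
  ... | inj₁ 0≤x = 0≤x
  ... | inj₂ x≤0 = ≤-respʳ-≈ (+-identityˡ _) (≤⇒0≤- x≤0)

  x²≤1⇒x≤1 : ∀ {x} → x * x ≤ 1# → x ≤ 1#
  x²≤1⇒x≤1 {x} x²≤1 with total x 1#
  ... | inj₁ x≤1 = x≤1
  ... | inj₂ 1≤x = by-difference (≤⇒0≤- x²≤1 ⊕ (≤-trans 0≤1 1≤x ⊗ ≤⇒0≤- 1≤x))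
    (solve 1 (λ x → con (+ 1) :- x :* x :+ x :* (x :- con (+ 1)) := con (+ 1) :- x) refl x)

  -- The search ends because the fuel `n` bounds the distance from `a`; a point of a known pixel
  -- provides such a bound. In a total order the negated `≤` expresses the strict upper bound of a
  -- floor.
  floor-search : ∀ {y} a n → fromℤ a ≤ y → ¬ fromℤ a + fromℕ n ≤ y →
                 ∃[ u ] (fromℤ u ≤ y) × ¬ fromℤ u + 1# ≤ y
  floor-search {y} a zero    a≤y a+n≰y = contradiction (≤-respˡ-≈ (sym (+-identityʳ _)) a≤y) a+n≰y
  floor-search {y} a (suc n) a≤y a+n≰y with (fromℤ a + 1#) ≤? y
  ... | no  a+1≰y = a , a≤y , a+1≰y
  ... | yes a+1≤y = floor-search (ℤ.suc a) n (≤-respˡ-≈ (sym (fromℤ-suc a)) a+1≤y)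
    λ le → a+n≰y (≤-respˡ-≈ (trans (+-congʳ (fromℤ-suc a)) (+-assoc _ _ _)) le)

-- Walks through all pixels

infixr 5 _∷_

data Walk {A : Set} (R : A → A → Set) : A → A → ℕ → Set where
  []  : ∀ {a} → Walk R a a 0
  _∷_ : ∀ {a b c n} → R a b → Walk R b c n → Walk R a c (suc n)

data Visits {A : Set} {R : A → A → Set} (x : A) : ∀ {a c n} → Walk R a c n → Set where
  here  : ∀ {c n} {w : Walk R x c n} → Visits x w
  there : ∀ {a b c n} {r : R a b} {w : Walk R b c n} → Visits x w → Visits x (r ∷ w)

module _ {A : Set} {R : A → A → Set} where

  snoc : ∀ {a b c n} → Walk R a b n → R b c → Walk R a c (suc n)
  snoc []      s = s ∷ []
  snoc (r ∷ w) s = r ∷ snoc w s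

  snoc-visits : ∀ {a b c n x} {w : Walk R a b n} (s : R b c) → Visits x w → Visits x (snoc w s)
  snoc-visits s here      = here
  snoc-visits s (there v) = there (snoc-visits s v)

  map-walk : ∀ {B : Set} {S : B → B → Set} {f : A → B} → (∀ {a b} → R a b → S (f a) (f b)) →
             ∀ {a c n} → Walk R a c n → Walk S (f a) (f c) n
  map-walk g []      = []
  map-walk g (r ∷ w) = g r ∷ map-walk g w

  map-visits : ∀ {B : Set} {S : B → B → Set} {f : A → B} (g : ∀ {a b} → R a b → S (f a) (f b)) →
               ∀ {a c n x} {w : Walk R a c n} → Visits x w → Visits (f x) (map-walk {S = S} g w)
  map-visits g here      = here
  map-visits g (there v) = there (map-visits g v)

  -- This hangs a leaf on the spanning tree: stepping to `y` and back where the walk visits `x`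
  -- costs two steps, the source of 2N, and leaves the endpoints and all earlier visits in place.
  detour : ∀ {a c n x y} → R x y → R y x → (w : Walk R a c n) → Visits x w →
           Σ[ w′ ∈ Walk R a c (2 ℕ.+ n) ] Visits y w′ × (∀ {z} → Visits z w → Visits z w′)
  detour r r′ w       here      = r ∷ r′ ∷ w , there here , λ v → there (there v)
  detour r r′ (e ∷ w) (there v) = let w′ , y∈w′ , keep = detour r r′ w v in
    e ∷ w′ , there y∈w′ , λ { here → here ; (there u) → there (keep u) }

EdgeAdjacent-sym : ∀ a b → EdgeAdjacent a b → EdgeAdjacent b a
EdgeAdjacent-sym (i , j) (k , l) adj =
  ≡.trans (≡.cong₂ ℕ._+_ (ℤ.∣i-j∣≡∣j-i∣ k i) (ℤ.∣i-j∣≡∣j-i∣ l j)) adj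

module SpanningWalk (P : Polyomino) where

  Edge : Pixel → Pixel → Set
  Edge a b = a ∈ pixels P × b ∈ pixels P × EdgeAdjacent a b

  Edge-sym : ∀ {a b} → Edge a b → Edge b a
  Edge-sym {a} {b} (a∈ , b∈ , adj) = b∈ , a∈ , EdgeAdjacent-sym a b adj

  private
    Pending : ∀ {a c n} → List Pixel → Walk Edge a c n → Set
    Pending qs w = ∀ {q} → q ∈ pixels P → q ∈ qs ⊎ Visits q w

  -- Follow a connecting path from a visited pixel. As long as `pending` reports visited pixels the
  -- walk can be used as a base; the first pixel reported in `qs` is reached by an edge from a
  -- visited one.
  frontier : ∀ {a c n qs x q} {w : Walk Edge a c n} → Pending qs w → x ∈ pixels P → Visits x w →
             Star (λ x y → y ∈ pixels P × EdgeAdjacent x y) x q →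
             Visits q w ⊎ ∃[ y ] ∃[ z ] Visits y w × z ∈ qs × Edge y z
  frontier pending x∈P x∈w ε = inj₁ x∈w
  frontier pending x∈P x∈w ((y∈P , adj) ◅ path) with pending y∈P
  ... | inj₁ y∈qs = inj₂ (_ , _ , x∈w , y∈qs , x∈P , y∈P , adj)
  ... | inj₂ y∈w  = frontier pending y∈P y∈w path

  -- The recursion is on the number `m`, because a pixel is removed from the middle of `qs` and the
  -- remainder is no structural part of it. Every pending pixel has a budget of two steps.
  extend : ∀ {p} → p ∈ pixels P → ∀ m qs → length qs ≡ m → All (_∈ pixels P) qs →
           ∀ {n} (w : Walk Edge p p n) → Pending qs w →
           ∃[ n′ ] Σ[ w′ ∈ Walk Edge p p n′ ] n′ ℕ.≤ m ℕ.+ m ℕ.+ n × (∀ {q} → q ∈ pixels P → Visits q w′)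
  extend p∈P _ [] ≡.refl _ w pending = _ , w , ℕ.≤-refl , λ q∈P → [ (λ ()) , (λ v → v) ]′ (pending q∈P)
  extend p∈P (suc m) (q ∷ qs) len (q∈P ∷ qs⊆P) {n} w pending
    with frontier pending p∈P here (connected P p∈P q∈P)
  ... | inj₁ q∈w = let n′ , w′ , n′≤ , all = extend p∈P m qs (ℕ.suc-injective len) qs⊆P w pending′ in
    n′ , w′ , ℕ.≤-trans n′≤ (ℕ.+-monoˡ-≤ n (ℕ.+-mono-≤ (ℕ.n≤1+n m) (ℕ.n≤1+n m))) , all
    where
    pending′ : Pending qs w
    pending′ r∈P with pending r∈P
    ... | inj₁ (here ≡.refl)   = inj₂ q∈w
    ... | inj₁ (there r∈qs)  = inj₁ r∈qs
    ... | inj₂ r∈w           = inj₂ r∈w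
  -- The pixel attached is `z`, where the path towards `q` first meets `qs`; `q` itself may stay
  -- pending.
  ... | inj₂ (y , z , y∈w , z∈qs , edge) with ∈.∈-∃++ z∈qs | detour edge (Edge-sym edge) w y∈w
  ... | as , bs , split | w₁ , z∈w₁ , keep =
    let n′ , w′ , n′≤ , all = extend p∈P m (as ++ bs) len′ rest⊆P w₁ pending′ in
    n′ , w′ , ≡.subst (n′ ℕ.≤_) (lemma m n) n′≤ , all
    where
    lemma : ∀ m n → m ℕ.+ m ℕ.+ (2 ℕ.+ n) ≡ suc m ℕ.+ suc m ℕ.+ n
    lemma = ℕ-Solver.solve-∀
    len′ : length (as ++ bs) ≡ m
    len′ = ℕ.suc-injective (≡.trans (≡.sym (List.length-++-sucʳ as z bs)) (≡.trans (≡.cong length (≡.sym split)) len))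
    qs⊆P′ : All (_∈ pixels P) (as ++ z ∷ bs)
    qs⊆P′ = ≡.subst (All _) split (q∈P ∷ qs⊆P)
    rest⊆P : All (_∈ pixels P) (as ++ bs)
    rest⊆P = All.++⁺ (All.++⁻ˡ as qs⊆P′) (All.tail (All.++⁻ʳ as qs⊆P′))
    pending′ : Pending (as ++ bs) w₁
    pending′ r∈P with pending r∈P
    ... | inj₂ r∈w = inj₂ (keep r∈w)
    ... | inj₁ r∈qs with ∈.∈-++⁻ as (≡.subst (_ ∈_) split r∈qs)
    ...   | inj₁ r∈as          = inj₁ (∈.∈-++⁺ˡ r∈as)
    ...   | inj₂ (here ≡.refl)   = inj₂ z∈w₁
    ...   | inj₂ (there r∈bs)  = inj₁ (∈.∈-++⁺ʳ as r∈bs)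

  spanning-walk : ∀ {p} qs → p ∈ pixels P → All (_∈ pixels P) qs → (∀ {q} → q ∈ pixels P → q ∈ qs) →
    ∃[ n ] Σ[ w ∈ Walk Edge p p n ] n ℕ.≤ length qs ℕ.+ length qs × (∀ {q} → q ∈ pixels P → Visits q w)
  spanning-walk qs p∈P qs⊆P P⊆qs =
    let n , w , n≤ , all = extend p∈P (length qs) qs ≡.refl qs⊆P [] (λ q∈P → inj₁ (P⊆qs q∈P)) in
    n , w , ≡.subst (n ℕ.≤_) (ℕ.+-identityʳ _) n≤ , all

-- Curves along walks

module Metric (ℝ : CompleteOrderedField) where

  open MWPDV ℝ
  open OrderedField ℝ
  open Solver using (solve; con; _:=_; _:+_; _:*_; _:-_; :-_)
  open Setoid pointSetoid using () renaming (refl to ≈ₚ-refl)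

  -- `total` is not assumed to respect `≈`, so equal arguments may take different branches of the
  -- absolute value. The two estimates through `∣x∣≤` hold on either branch.
  ∣∣-cong : ∀ {x y} → x ≈ y → ∣ x ∣ ≈ ∣ y ∣
  ∣∣-cong x≈y = antisym (mono x≈y) (mono (sym x≈y))
    where
    mono : ∀ {x y} → x ≈ y → ∣ x ∣ ≤ ∣ y ∣
    mono {x} {y} x≈y = ∣x∣≤ (≤-respˡ-≈ (sym x≈y) (x≤∣x∣ y)) (≤-respˡ-≈ (-‿cong (sym x≈y)) (-x≤∣x∣ y))

  d₁-cong : ∀ {p p′ q q′} → p ≈ₚ p′ → q ≈ₚ q′ → d₁ p q ≈ d₁ p′ q′
  d₁-cong (px , py) (qx , qy) =
    +-cong (∣∣-cong (+-cong qx (-‿cong px))) (∣∣-cong (+-cong qy (-‿cong py)))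

  private
    ∣∣-flip-≤ : ∀ x y → ∣ x - y ∣ ≤ ∣ y - x ∣
    ∣∣-flip-≤ x y = ∣x∣≤
      (≤-respˡ-≈ (solve 2 (λ x y → :- (y :- x) := x :- y) refl x y) (-x≤∣x∣ (y - x)))
      (≤-respˡ-≈ (solve 2 (λ x y → y :- x := :- (x :- y)) refl x y) (x≤∣x∣ (y - x)))

    ∣∣-triangle : ∀ x y z → ∣ z - x ∣ ≤ ∣ y - x ∣ + ∣ z - y ∣
    ∣∣-triangle x y z = ∣x∣≤
      (≤-respˡ-≈ (solve 3 (λ x y z → (y :- x) :+ (z :- y) := z :- x) refl x y z)
        (+-mono-≤ (x≤∣x∣ (y - x)) (x≤∣x∣ (z - y))))
      (≤-respˡ-≈ (solve 3 (λ x y z → (:- (y :- x)) :+ (:- (z :- y)) := :- (z :- x)) refl x y z)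
        (+-mono-≤ (-x≤∣x∣ (y - x)) (-x≤∣x∣ (z - y))))

    ∣∣≤0 : ∀ x y → ∣ y - x ∣ ≤ 0# → x ≈ y
    ∣∣≤0 x y d≤0 = antisym
      (by-difference (≤⇒0≤- (≤-trans (-x≤∣x∣ (y - x)) d≤0)) (solve 2 (λ x y → con (+ 0) :- (:- (y :- x)) := y :- x) refl x y))
      (by-difference (≤⇒0≤- (≤-trans (x≤∣x∣ (y - x)) d≤0)) (solve 2 (λ x y → con (+ 0) :- (y :- x) := x :- y) refl x y))

    ∣∣-scale : ∀ {k} x → 0# ≤ k → ∣ k * x ∣ ≤ k * ∣ x ∣
    ∣∣-scale {k} x 0≤k = ∣x∣≤
      (by-difference (0≤k ⊗ ≤⇒0≤- (x≤∣x∣ x)) (solve 3 (λ k x y → k :* (y :- x) := k :* y :- k :* x) refl k x (∣ x ∣)))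
      (by-difference (0≤k ⊗ ≤⇒0≤- (-x≤∣x∣ x)) (solve 3 (λ k x y → k :* (y :- (:- x)) := k :* y :- (:- (k :* x))) refl k x (∣ x ∣)))

  d₁-sym-≤ : ∀ p q → d₁ p q ≤ d₁ q p
  d₁-sym-≤ (x , y) (x′ , y′) = +-mono-≤ (∣∣-flip-≤ x′ x) (∣∣-flip-≤ y′ y)

  d₁-triangle : ∀ p q r → d₁ p r ≤ d₁ p q + d₁ q r
  d₁-triangle (x , y) (x′ , y′) (x″ , y″) = ≤-respʳ-≈
    (solve 4 (λ a b c d → (a :+ b) :+ (c :+ d) := (a :+ c) :+ (b :+ d)) refl
      (∣ x′ - x ∣) (∣ x″ - x′ ∣) (∣ y′ - y ∣) (∣ y″ - y′ ∣))
    (+-mono-≤ (∣∣-triangle x x′ x″) (∣∣-triangle y y′ y″))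

  d₁≤0⇒≈ : ∀ p q → d₁ p q ≤ 0# → p ≈ₚ q
  d₁≤0⇒≈ (x , y) (x′ , y′) d≤0 =
    ∣∣≤0 x x′ (≤-trans (≤-respˡ-≈ (+-identityʳ _) (+-mono-≤ ≤-refl (0≤∣x∣ (y′ - y)))) d≤0) ,
    ∣∣≤0 y y′ (≤-trans (≤-respˡ-≈ (+-identityˡ _) (+-mono-≤ (0≤∣x∣ (x′ - x)) ≤-refl)) d≤0)

  ≈⇒d₁≤0 : ∀ {p q} → p ≈ₚ q → d₁ p q ≤ 0#
  ≈⇒d₁≤0 {p} p≈q = ≤-respˡ-≈ (d₁-cong (≈ₚ-refl {p}) p≈q)
    (≤-respʳ-≈ (+-identityˡ 0#) (+-mono-≤ (self _) (self _)))
    where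
    self : ∀ x → ∣ x - x ∣ ≤ 0#
    self x = ∣x∣≤ (≤-reflexive (-‿inverseʳ x))
                  (≤-reflexive (solve 1 (λ x → :- (x :- x) := con (+ 0)) refl x))

  convex-0 : ∀ p q → convex 0# p q ≈ₚ p
  convex-0 (x , y) (x′ , y′) = coordinate x x′ , coordinate y y′
    where
    coordinate : ∀ x x′ → (1# - 0#) * x + 0# * x′ ≈ x
    coordinate = solve 2 (λ x x′ → (con (+ 1) :- con (+ 0)) :* x :+ con (+ 0) :* x′ := x) refl

  convex-1 : ∀ p q → convex 1# p q ≈ₚ q
  convex-1 (x , y) (x′ , y′) = coordinate x x′ , coordinate y y′
    where
    coordinate : ∀ x x′ → (1# - 1#) * x + 1# * x′ ≈ x′
    coordinate = solve 2 (λ x x′ → (con (+ 1) :- con (+ 1)) :* x :+ con (+ 1) :* x′ := x′) refl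

  convex-cong : ∀ {s t} p q → s ≈ t → convex s p q ≈ₚ convex t p q
  convex-cong p q s≈t =
    +-cong (*-congʳ (+-congˡ (-‿cong s≈t))) (*-congʳ s≈t) ,
    +-cong (*-congʳ (+-congˡ (-‿cong s≈t))) (*-congʳ s≈t)

  convex-lipschitz : ∀ {s t} p q → d₁ p q ≤ 1# → s ≤ t → d₁ (convex s p q) (convex t p q) ≤ t - s
  convex-lipschitz {s} {t} (x , y) (x′ , y′) d≤1 s≤t = ≤-trans
    (+-mono-≤ (coordinate x x′) (coordinate y y′))
    (by-difference (≤⇒0≤- s≤t ⊗ ≤⇒0≤- d≤1)
      (solve 4 (λ s t a b → (t :- s) :* (con (+ 1) :- (a :+ b)) := t :- s :- ((t :- s) :* a :+ (t :- s) :* b)) refl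
        s t (∣ x′ - x ∣) (∣ y′ - y ∣)))
    where
    coordinate : ∀ x x′ → ∣ (1# - t) * x + t * x′ - ((1# - s) * x + s * x′) ∣ ≤ (t - s) * ∣ x′ - x ∣
    coordinate x x′ = ≤-respˡ-≈ (∣∣-cong
      (solve 4 (λ s t x x′ → (t :- s) :* (x′ :- x) :=
         (con (+ 1) :- t) :* x :+ t :* x′ :- ((con (+ 1) :- s) :* x :+ s :* x′)) refl s t x x′))
      (∣∣-scale (x′ - x) (≤⇒0≤- s≤t))

module Traversal (ℝ : CompleteOrderedField) (P : Polyomino) where

  open MWPDV ℝ
  open OrderedField ℝ
  open Metric ℝ
  open Solver using (solve; con; _:=_; _:+_; _:*_; _:-_; :-_)
  open Setoid pointSetoid using ()
    renaming (refl to ≈ₚ-refl; sym to ≈ₚ-sym; trans to ≈ₚ-trans)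

  -- Length at most 1 lets each step take one unit of time at speed at most 1, so that elapsed time
  -- bounds length.
  Step : Point → Point → Set
  Step p q = d₁ p q ≤ 1# × (∀ s → UnitInterval s → convex s p q ∈ᴾ P)

  -- Constant after the end of the walk; meaningless for t < 0.
  position : ∀ {a c n} → Walk Step a c n → Carrier → Point
  position {a} [] t = a
  position (_∷_ {a} {b} _ w) t with t ≤? 1#
  ... | yes _ = convex t a b
  ... | no  _ = position w (t - 1#)

  private
    ≰⇒≥ : ∀ {x y} → ¬ x ≤ y → y ≤ x
    ≰⇒≥ {x} {y} x≰y = [ (λ x≤y → contradiction x≤y x≰y) , (λ y≤x → y≤x) ]′ (total x y)

    pred-≤ : ∀ {x y} → x ≤ y → x - 1# ≤ y - 1#
    pred-≤ x≤y = +-mono-≤ x≤y ≤-refl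

  position-inside : ∀ {a c n} (w : Walk Step a c n) → c ∈ᴾ P → ∀ {t} → 0# ≤ t → position w t ∈ᴾ P
  position-inside []            c∈P 0≤t = c∈P
  position-inside ((_ , segment) ∷ w) c∈P {t} 0≤t with t ≤? 1#
  ... | yes t≤1 = segment t (0≤t , t≤1)
  ... | no  t≰1 = position-inside w c∈P (≤⇒0≤- (≰⇒≥ t≰1))

  position-0 : ∀ {a c n} (w : Walk Step a c n) → position w 0# ≈ₚ a
  position-0 [] = ≈ₚ-refl
  position-0 (_∷_ {a} {b} _ w) with 0# ≤? 1#
  ... | yes _   = convex-0 a b
  ... | no  0≰1 = contradiction 0≤1 0≰1

  -- The single estimate behind continuity, the length bound and even the congruence of the curve:
  -- equal times yield points at distance at most 0. When the time interval contains the corner `b`,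
  -- it is split there.
  position-lipschitz : ∀ {a c n} (w : Walk Step a c n) {s t} → 0# ≤ s → s ≤ t →
                       d₁ (position w s) (position w t) ≤ t - s
  position-lipschitz [] 0≤s s≤t = ≤-trans (≈⇒d₁≤0 ≈ₚ-refl) (≤⇒0≤- s≤t)
  position-lipschitz (_∷_ {a} {b} (d≤1 , _) w) {s} {t} 0≤s s≤t with s ≤? 1# | t ≤? 1#
  ... | yes _   | yes _   = convex-lipschitz a b d≤1 s≤t
  ... | no  s≰1 | yes t≤1 = contradiction (≤-trans s≤t t≤1) s≰1
  ... | no  s≰1 | no  _   = ≤-respʳ-≈ (solve 2 (λ s t → t :- con (+ 1) :- (s :- con (+ 1)) := t :- s) refl s t)
    (position-lipschitz w (≤⇒0≤- (≰⇒≥ s≰1)) (pred-≤ s≤t))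
  ... | yes s≤1 | no  t≰1 = ≤-respʳ-≈
    (solve 2 (λ s t → con (+ 1) :- s :+ (t :- con (+ 1) :- con (+ 0)) := t :- s) refl s t)
    (≤-trans (d₁-triangle (convex s a b) b (position w (t - 1#))) (+-mono-≤
      (≤-respˡ-≈ (d₁-cong (≈ₚ-refl {convex s a b}) (convex-1 a b)) (convex-lipschitz a b d≤1 s≤1))
      (≤-respˡ-≈ (d₁-cong (position-0 w) (≈ₚ-refl {position w (t - 1#)}))
        (position-lipschitz w ≤-refl (≤⇒0≤- (≰⇒≥ t≰1))))))

  position-cong : ∀ {a c n} (w : Walk Step a c n) {s t} → 0# ≤ s → s ≈ t → position w s ≈ₚ position w t
  position-cong w {s} {t} 0≤s s≈t = d₁≤0⇒≈ (position w s) (position w t)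
    (≤-respʳ-≈ (trans (+-congˡ (-‿cong s≈t)) (-‿inverseʳ t)) (position-lipschitz w 0≤s (≤-reflexive s≈t)))

  position-∷ : ∀ {a b c n} (r : Step a b) (w : Walk Step b c n) {t} → 0# ≤ t →
               position (r ∷ w) (1# + t) ≈ₚ position w t
  position-∷ {a} {b} r w {t} 0≤t with (1# + t) ≤? 1#
  ... | no  _     = ≈ₚ-sym (position-cong w 0≤t (solve 1 (λ t → t := con (+ 1) :+ t :- con (+ 1)) refl t))
  -- Here `t` is 0, and time 1 still belongs to the first segment; its end `b` is the start of `w`.
  ... | yes 1+t≤1 =
    ≈ₚ-trans (convex-cong a b (trans (+-congˡ (sym 0≈t)) (+-identityʳ 1#)))
    (≈ₚ-trans (convex-1 a b)
    (≈ₚ-trans (≈ₚ-sym (position-0 w)) (position-cong w ≤-refl 0≈t)))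
    where
    0≈t : 0# ≈ t
    0≈t = antisym 0≤t (by-difference (≤⇒0≤- 1+t≤1)
      (solve 1 (λ t → con (+ 1) :- (con (+ 1) :+ t) := con (+ 0) :- t) refl t))

  position-end : ∀ {a c n} (w : Walk Step a c n) {t} → fromℕ n ≤ t → position w t ≈ₚ c
  position-end []      _ = ≈ₚ-refl
  position-end {n = suc n} (r ∷ w) {t} 1+n≤t =
    ≈ₚ-trans (position-cong (r ∷ w) (≤-trans (0≤fromℕ (suc n)) 1+n≤t)
               (solve 1 (λ t → t := con (+ 1) :+ (t :- con (+ 1))) refl t))
    (≈ₚ-trans (position-∷ r w (≤-trans (0≤fromℕ n) n≤t-1)) (position-end w n≤t-1))
    where
    n≤t-1 : fromℕ n ≤ t - 1#
    n≤t-1 = ≤-respˡ-≈ (solve 1 (λ n → con (+ 1) :+ n :- con (+ 1) := n) refl (fromℕ n)) (pred-≤ 1+n≤t)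

  position-visits : ∀ {a c n x} {w : Walk Step a c n} → Visits x w →
                    ∃[ t ] (0# ≤ t) × (t ≤ fromℕ n) × (position w t ≈ₚ x)
  position-visits {n = n} {w = w} here = 0# , ≤-refl , 0≤fromℕ n , position-0 w
  position-visits {w = r ∷ w} (there v) =
    let t , 0≤t , t≤n , at-t = position-visits v in
    1# + t , 0≤1 ⊕ 0≤t , +-mono-≤ ≤-refl t≤n , ≈ₚ-trans (position-∷ r w 0≤t) at-t

  module ClosedWalk {a n} (w : Walk Step a a n) where

    -- One unit longer than the walk, so that it is never 0.
    duration : Carrier
    duration = fromℕ (suc n)

    curve : Carrier → Point
    curve t = position w (duration * t)

    private
      0≤duration : 0# ≤ duration
      0≤duration = 0≤fromℕ (suc n)

    curve-lipschitz : ∀ {s t} → 0# ≤ s → s ≤ t → d₁ (curve s) (curve t) ≤ duration * (t - s)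
    curve-lipschitz {s} {t} 0≤s s≤t = ≤-respʳ-≈
      (solve 3 (λ d s t → d :* t :- d :* s := d :* (t :- s)) refl duration s t)
      (position-lipschitz w (0≤duration ⊗ 0≤s) (by-difference (0≤duration ⊗ ≤⇒0≤- s≤t)
        (solve 3 (λ d s t → d :* (t :- s) := d :* t :- d :* s) refl duration s t)))

    curve-continuous : Continuous curve
    curve-continuous η (0≤η , 0≉η) =
      let w , 0≤w , dw≈1 = fromℕ-inverse n
          dηw≈η : duration * (η * w) ≈ η
          dηw≈η = trans (solve 3 (λ d e w → d :* (e :* w) := d :* w :* e) refl duration η w)
                        (trans (*-congʳ dw≈1) (*-identityˡ η))
          ordered : ∀ {s t} → 0# ≤ s → s ≤ t → ∣ t - s ∣ ≤ η * w → d₁ (curve s) (curve t) ≤ η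
          ordered 0≤s s≤t close = ≤-respʳ-≈ dηw≈η (≤-trans (curve-lipschitz 0≤s s≤t)
            (by-difference (0≤duration ⊗ ≤⇒0≤- (≤-trans (x≤∣x∣ _) close))
              (solve 3 (λ d u v → d :* (u :- v) := d :* u :- d :* v) refl duration (η * w) _)))
      in η * w , (0≤η ⊗ 0≤w , λ 0≈ηw → 0≉η (trans (sym (zeroʳ duration)) (trans (*-congˡ 0≈ηw) dηw≈η))) ,
         λ s t (0≤s , _) (0≤t , _) close →
           [ (λ s≤t → ordered 0≤s s≤t close)
           , (λ t≤s → ≤-trans (d₁-sym-≤ (curve s) (curve t))
                        (ordered 0≤t t≤s (≤-trans (flip s t) close))) ]′ (total s t)
      where
      flip : ∀ s t → ∣ s - t ∣ ≤ ∣ t - s ∣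
      flip s t = ∣x∣≤
        (≤-respˡ-≈ (solve 2 (λ x y → :- (y :- x) := x :- y) refl s t) (-x≤∣x∣ (t - s)))
        (≤-respˡ-≈ (solve 2 (λ x y → y :- x := :- (x :- y)) refl s t) (x≤∣x∣ (t - s)))

    curve-0 : curve 0# ≈ₚ a
    curve-0 = ≈ₚ-trans (position-cong w (0≤duration ⊗ ≤-refl) (zeroʳ duration)) (position-0 w)

    curve-1 : curve 1# ≈ₚ a
    curve-1 = position-end w (by-difference 0≤1
      (solve 1 (λ n → con (+ 1) := (con (+ 1) :+ n) :* con (+ 1) :- n) refl (fromℕ n)))

    inscribed-≤ : ∀ t ts → Partition (t ∷ ts) → polylineLength (map curve (t ∷ ts)) ≤ duration * (1# - t)
    inscribed-≤ t []        (_ , (_ , t≤1) ∷ []) = 0≤duration ⊗ ≤⇒0≤- t≤1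
    inscribed-≤ t (t′ ∷ ts) (t≤t′ ∷ sorted , (0≤t , _) ∷ units) = ≤-respʳ-≈
      (solve 3 (λ d t t′ → d :* (t′ :- t) :+ d :* (con (+ 1) :- t′) := d :* (con (+ 1) :- t)) refl duration t t′)
      (+-mono-≤ (curve-lipschitz 0≤t t≤t′) (inscribed-≤ t′ ts (sorted , units)))

    inscribed-bounded : UpperBound _≤_ (InscribedLength curve) duration
    inscribed-bounded ([] , _ , x≈) = ≤-respˡ-≈ (sym x≈) 0≤duration
    inscribed-bounded (t ∷ ts , (sorted , (0≤t , t≤1) ∷ units) , x≈) = ≤-respˡ-≈ (sym x≈)
      (≤-trans (inscribed-≤ t ts (sorted , (0≤t , t≤1) ∷ units)) (by-difference (0≤duration ⊗ 0≤t)
        (solve 2 (λ d t → d :* t := d :- d :* (con (+ 1) :- t)) refl duration t)))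

    private
      -- The exact length is never computed: completeness provides it, with the empty partition as
      -- inhabitant and `duration` as bound, and that bound is all the cost estimate asks for.
      length-supremum : ∃ (LeastUpperBound _≤_ (InscribedLength curve))
      length-supremum = supremum (InscribedLength curve) (0# , [] , ([] , []) , refl) (duration , inscribed-bounded)

    closed-tour : Tour
    closed-tour = record
      { path       = curve
      ; continuous = curve-continuous
      ; closed     = ≈ₚ-trans curve-0 (≈ₚ-sym curve-1)
      ; tourLength = proj₁ length-supremum
      ; isLength   = proj₂ length-supremum
      }

    tourLength-≤ : tourLength closed-tour ≤ duration
    tourLength-≤ = proj₂ (proj₂ length-supremum) inscribed-bounded

    closed-tour-inside : a ∈ᴾ P → ∀ t → UnitInterval t → curve t ∈ᴾ P
    closed-tour-inside a∈P t (0≤t , _) = position-inside w a∈P (0≤duration ⊗ 0≤t)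

    visited-OnTour : ∀ {x} → Visits x w → x OnTour closed-tour
    visited-OnTour v =
      let t , 0≤t , t≤n , at-t = position-visits v
          u , 0≤u , du≈1 = fromℕ-inverse n
          t≈dut : t ≈ duration * (u * t)
          t≈dut = trans (sym (*-identityˡ t)) (trans (*-congʳ (sym du≈1)) (*-assoc duration u t))
      in u * t ,
         ( 0≤u ⊗ 0≤t
         , fromℕ-*-cancel-≤ n (≤-respˡ-≈ t≈dut (≤-trans t≤n (by-difference 0≤1
             (solve 1 (λ n → con (+ 1) := (con (+ 1) :+ n) :* con (+ 1) :- n) refl (fromℕ n))))) ) ,
         ≈ₚ-trans (≈ₚ-sym (position-cong w 0≤t t≈dut)) at-t

-- The tour through the pixel centres

_≟ₚ_ : DecidableEquality Pixel
_≟ₚ_ = ≡-dec ℤ._≟_ ℤ._≟_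

-- The list of a polyomino may repeat pixels, whereas area counts each once and the scan points have
-- to be distinct.
distinctPixels : Polyomino → List Pixel
distinctPixels P = deduplicate _≟ₚ_ (pixels P)

distinctPixels-unique : ∀ P → Unique (distinctPixels P)
distinctPixels-unique P = UniqueDec.deduplicate-! _≟ₚ_ (pixels P)

∈-distinctPixels⁺ : ∀ P {p} → p ∈ pixels P → p ∈ distinctPixels P
∈-distinctPixels⁺ P = ∈.∈-deduplicate⁺ _≟ₚ_

∈-distinctPixels⁻ : ∀ P {p} → p ∈ distinctPixels P → p ∈ pixels P
∈-distinctPixels⁻ P = ∈.∈-deduplicate⁻ _≟ₚ_ (pixels P)

area : Polyomino → ℕ
area P = length (distinctPixels P)

i≤∣i∣ : ∀ i → i ℤ.≤ + ℤ.∣ i ∣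
i≤∣i∣ (+ n)    = ℤ.≤-refl
i≤∣i∣ -[1+ n ] = ℤ.-≤+

module PixelGeometry (ℝ : CompleteOrderedField) where

  open MWPDV ℝ
  open OrderedField ℝ
  open Solver using (solve; con; _:=_; _:+_; _:*_; _:-_; :-_)

  abstract
    ½ : Carrier
    ½ = proj₁ (fromℕ-inverse 1)

    0≤½ : 0# ≤ ½
    0≤½ = proj₁ (proj₂ (fromℕ-inverse 1))

    ½+½≈1 : ½ + ½ ≈ 1#
    ½+½≈1 = trans (solve 1 (λ h → h :+ h := con (+ 2) :* h) refl ½) (proj₂ (proj₂ (fromℕ-inverse 1)))

  private
    -- The solver treats `½` as a variable; the equation `½+½≈1` enters linear arithmetic through
    -- this inequality and the next.
    0≤1-½-½ : 0# ≤ 1# - (½ + ½)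
    0≤1-½-½ = ≤⇒0≤- (≤-reflexive ½+½≈1)

    0≤½+½-1 : 0# ≤ ½ + ½ - 1#
    0≤½+½-1 = ≤⇒0≤- (≤-reflexive (sym ½+½≈1))

  center : Pixel → Point
  center (i , j) = fromℤ i + ½ , fromℤ j + ½

  center-injective : ∀ {p q} → center p ≈ₚ center q → p ≡ q
  center-injective (x≈ , y≈) = ≡.cong₂ _,_ (cancel x≈) (cancel y≈)
    where
    cancel : ∀ {i j} → fromℤ i + ½ ≈ fromℤ j + ½ → i ≡ j
    cancel {i} {j} eq = fromℤ-injective (trans (drop i) (trans (+-congʳ eq) (sym (drop j))))
      where
      drop : ∀ i → fromℤ i ≈ fromℤ i + ½ - ½
      drop i = solve 2 (λ x h → x := x :+ h :- h) refl (fromℤ i) ½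

  InPixel-center : ∀ p → InPixel (center p) p
  InPixel-center (i , j) = coordinate i , coordinate j
    where
    coordinate : ∀ i → (fromℤ i ≤ fromℤ i + ½) × (fromℤ i + ½ ≤ fromℤ i + 1#)
    coordinate i =
      by-difference 0≤½ (solve 2 (λ x h → h := x :+ h :- x) refl (fromℤ i) ½) ,
      by-difference (0≤1-½-½ ⊕ 0≤½)
        (solve 2 (λ x h → con (+ 1) :- (h :+ h) :+ h := x :+ con (+ 1) :- (x :+ h)) refl (fromℤ i) ½)

  InPixel-convex : ∀ p {a b s} → UnitInterval s → InPixel a p → InPixel b p → InPixel (convex s a b) p
  InPixel-convex (i , j) {a} {b} {s} (0≤s , s≤1) (ax , ay) (bx , by) = coordinate i ax bx , coordinate j ay by
    where
    coordinate : ∀ i {x y} → (fromℤ i ≤ x) × (x ≤ fromℤ i + 1#) → (fromℤ i ≤ y) × (y ≤ fromℤ i + 1#) →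
      (fromℤ i ≤ (1# - s) * x + s * y) × ((1# - s) * x + s * y ≤ fromℤ i + 1#)
    coordinate i {x} {y} (i≤x , x≤i+1) (i≤y , y≤i+1) =
      by-difference (≤⇒0≤- s≤1 ⊗ ≤⇒0≤- i≤x ⊕ 0≤s ⊗ ≤⇒0≤- i≤y)
        (solve 4 (λ s x y i → (con (+ 1) :- s) :* (x :- i) :+ s :* (y :- i)
          := (con (+ 1) :- s) :* x :+ s :* y :- i) refl s x y (fromℤ i)) ,
      by-difference (≤⇒0≤- s≤1 ⊗ ≤⇒0≤- x≤i+1 ⊕ 0≤s ⊗ ≤⇒0≤- y≤i+1)
        (solve 4 (λ s x y i → (con (+ 1) :- s) :* (i :+ con (+ 1) :- x) :+ s :* (i :+ con (+ 1) :- y)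
          := i :+ con (+ 1) :- ((con (+ 1) :- s) :* x :+ s :* y)) refl s x y (fromℤ i))

  -½≤offset≤½ : ∀ i {x} → (fromℤ i ≤ x) × (x ≤ fromℤ i + 1#) →
            (x - (fromℤ i + ½) ≤ ½) × (- (x - (fromℤ i + ½)) ≤ ½)
  -½≤offset≤½ i {x} (i≤x , x≤i+1) =
    by-difference (≤⇒0≤- x≤i+1 ⊕ 0≤½+½-1)
      (solve 3 (λ x i h → i :+ con (+ 1) :- x :+ (h :+ h :- con (+ 1)) := h :- (x :- (i :+ h))) refl x (fromℤ i) ½) ,
    by-difference (≤⇒0≤- i≤x)
      (solve 3 (λ x i h → x :- i := h :- (:- (x :- (i :+ h)))) refl x (fromℤ i) ½)

  -- The corners attain the bound 1, so a prescribed grid point is joined to a pixel centre by a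
  -- single step.
  d₁-center-≤ : ∀ {a} p → InPixel a p → d₁ (center p) a ≤ 1#
  d₁-center-≤ (i , j) (ax , ay) = ≤-respʳ-≈ ½+½≈1
    (+-mono-≤ (∣x∣≤ (proj₁ (-½≤offset≤½ i ax)) (proj₂ (-½≤offset≤½ i ax)))
              (∣x∣≤ (proj₁ (-½≤offset≤½ j ay)) (proj₂ (-½≤offset≤½ j ay))))

  -- For offsets d and e the slack 1 - d² - e² is (½² - d²) + (½² - e²) + 2·½², because 4·½² = 1.
  -- Each difference of squares is a product of two nonnegative factors.
  WithinL₂-center : ∀ {a} p → InPixel a p → WithinL₂ 1# (center p) a
  WithinL₂-center {x , y} (i , j) (ax , ay) = by-difference
    (square (-½≤offset≤½ i ax) ⊕ square (-½≤offset≤½ j ay) ⊕ (0≤½ ⊗ 0≤½ ⊕ 0≤½ ⊗ 0≤½)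
      ⊕ ≤⇒0≤- (≤-reflexive (*-cong ½+½≈1 ½+½≈1)))
    (solve 3 (λ d e h → (h :- d) :* (h :- (:- d)) :+ (h :- e) :* (h :- (:- e)) :+ (h :* h :+ h :* h)
        :+ (con (+ 1) :* con (+ 1) :- (h :+ h) :* (h :+ h))
        := con (+ 1) :* con (+ 1) :- (d :* d :+ e :* e)) refl
      (x - (fromℤ i + ½)) (y - (fromℤ j + ½)) ½)
    where
    square : ∀ {d} → (d ≤ ½) × (- d ≤ ½) → 0# ≤ (½ - d) * (½ - - d)
    square (d≤½ , -d≤½) = ≤⇒0≤- d≤½ ⊗ ≤⇒0≤- -d≤½

  fromℤ-difference-≤ : ∀ i k → fromℤ k - fromℤ i ≤ fromℕ ℤ.∣ i ℤ.- k ∣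
  fromℤ-difference-≤ i k = ≤-respˡ-≈ (trans (fromℤ-+ k (ℤ.- i)) (+-congˡ (fromℤ-neg i)))
    (fromℤ-mono-≤ (≡.subst (λ m → k ℤ.- i ℤ.≤ + m) (ℤ.∣i-j∣≡∣j-i∣ k i) (i≤∣i∣ (k ℤ.- i))))

  private
    Near : ℤ → ℤ → Set
    Near i k = fromℤ k - fromℤ i ≤ 1#

  EdgeAdjacent⇒near : ∀ p q → EdgeAdjacent p q → Near (proj₁ p) (proj₁ q) × Near (proj₂ p) (proj₂ q)
  EdgeAdjacent⇒near (i , j) (k , l) adj =
    ≤-trans (fromℤ-difference-≤ i k) (bound {ℤ.∣ i ℤ.- k ∣} (ℕ.m+n≤o⇒m≤o _ (ℕ.≤-reflexive adj))) ,
    ≤-trans (fromℤ-difference-≤ j l) (bound {ℤ.∣ j ℤ.- l ∣} (ℕ.m+n≤o⇒n≤o ℤ.∣ i ℤ.- k ∣ (ℕ.≤-reflexive adj)))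
    where
    bound : ∀ {n} → n ℕ.≤ 1 → fromℕ n ≤ 1#
    bound n≤1 = ≤-respʳ-≈ (+-identityʳ 1#) (fromℕ-mono-≤ n≤1)

  d₁-centers-≤ : ∀ p q → EdgeAdjacent p q → d₁ (center p) (center q) ≤ 1#
  d₁-centers-≤ (i , j) (k , l) adj = ≤-respʳ-≈ total≈1 (+-mono-≤ (coordinate i k) (coordinate j l))
    where
    total≈1 : fromℕ ℤ.∣ i ℤ.- k ∣ + fromℕ ℤ.∣ j ℤ.- l ∣ ≈ 1#
    total≈1 = trans (sym (fromℕ-+ ℤ.∣ i ℤ.- k ∣ ℤ.∣ j ℤ.- l ∣))
                    (trans (reflexive (≡.cong fromℕ adj)) (+-identityʳ 1#))
    coordinate : ∀ i k → ∣ fromℤ k + ½ - (fromℤ i + ½) ∣ ≤ fromℕ ℤ.∣ i ℤ.- k ∣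
    coordinate i k = ∣x∣≤
      (≤-respˡ-≈ (solve 3 (λ i k h → k :- i := k :+ h :- (i :+ h)) refl (fromℤ i) (fromℤ k) ½)
        (fromℤ-difference-≤ i k))
      (≤-respˡ-≈ (solve 3 (λ i k h → i :- k := :- (k :+ h :- (i :+ h))) refl (fromℤ i) (fromℤ k) ½)
        (≡.subst (λ n → fromℤ i - fromℤ k ≤ fromℕ n) (ℤ.∣i-j∣≡∣j-i∣ k i) (fromℤ-difference-≤ k i)))

  -- The segment stays in `p` up to its midpoint and in `q` from there on. A bound of 1 on each
  -- coordinate difference suffices, which treats horizontal and vertical neighbours alike.
  convex-centers : ∀ p q → EdgeAdjacent p q → ∀ s → UnitInterval s →
                   InPixel (convex s (center p) (center q)) p ⊎ InPixel (convex s (center p) (center q)) q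
  convex-centers (i , j) (k , l) adj s (0≤s , s≤1) with total s ½
  ... | inj₁ s≤½ = inj₁ (coordinate i k (proj₁ pq) (proj₁ qp) , coordinate j l (proj₂ pq) (proj₂ qp))
    where
    pq = EdgeAdjacent⇒near (i , j) (k , l) adj
    qp = EdgeAdjacent⇒near (k , l) (i , j) (EdgeAdjacent-sym (i , j) (k , l) adj)
    coordinate : ∀ i k → Near i k → Near k i →
      let x = (1# - s) * (fromℤ i + ½) + s * (fromℤ k + ½) in (fromℤ i ≤ x) × (x ≤ fromℤ i + 1#)
    coordinate i k ik ki =
      by-difference (≤⇒0≤- s≤½ ⊕ 0≤s ⊗ ≤⇒0≤- ki)
        (solve 4 (λ s h i k → (h :- s) :+ s :* (con (+ 1) :- (i :- k))
          := (con (+ 1) :- s) :* (i :+ h) :+ s :* (k :+ h) :- i) refl s ½ (fromℤ i) (fromℤ k)) ,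
      by-difference (0≤1-½-½ ⊕ ≤⇒0≤- s≤½ ⊕ 0≤s ⊗ ≤⇒0≤- ik)
        (solve 4 (λ s h i k → con (+ 1) :- (h :+ h) :+ (h :- s) :+ s :* (con (+ 1) :- (k :- i))
          := i :+ con (+ 1) :- ((con (+ 1) :- s) :* (i :+ h) :+ s :* (k :+ h))) refl s ½ (fromℤ i) (fromℤ k))
  ... | inj₂ ½≤s = inj₂ (coordinate i k (proj₁ pq) (proj₁ qp) , coordinate j l (proj₂ pq) (proj₂ qp))
    where
    pq = EdgeAdjacent⇒near (i , j) (k , l) adj
    qp = EdgeAdjacent⇒near (k , l) (i , j) (EdgeAdjacent-sym (i , j) (k , l) adj)
    coordinate : ∀ i k → Near i k → Near k i →
      let x = (1# - s) * (fromℤ i + ½) + s * (fromℤ k + ½) in (fromℤ k ≤ x) × (x ≤ fromℤ k + 1#)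
    coordinate i k ik ki =
      by-difference (≤⇒0≤- ½≤s ⊕ 0≤½+½-1 ⊕ ≤⇒0≤- s≤1 ⊗ ≤⇒0≤- ik)
        (solve 4 (λ s h i k → (s :- h) :+ (h :+ h :- con (+ 1)) :+ (con (+ 1) :- s) :* (con (+ 1) :- (k :- i))
          := (con (+ 1) :- s) :* (i :+ h) :+ s :* (k :+ h) :- k) refl s ½ (fromℤ i) (fromℤ k)) ,
      by-difference (≤⇒0≤- ½≤s ⊕ ≤⇒0≤- s≤1 ⊗ ≤⇒0≤- ki)
        (solve 4 (λ s h i k → (s :- h) :+ (con (+ 1) :- s) :* (con (+ 1) :- (i :- k))
          := k :+ con (+ 1) :- ((con (+ 1) :- s) :* (i :+ h) :+ s :* (k :+ h))) refl s ½ (fromℤ i) (fromℤ k))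

module CenterTour (ℝ : CompleteOrderedField) (P : Polyomino) where

  open MWPDV ℝ
  open OrderedField ℝ
  open Metric ℝ
  open PixelGeometry ℝ
  open Traversal ℝ P
  open SpanningWalk P

  Edge⇒Step : ∀ {p q} → Edge p q → Step (center p) (center q)
  Edge⇒Step {p} {q} (p∈P , q∈P , adj) = d₁-centers-≤ p q adj ,
    λ s unit → [ lose p∈P , lose q∈P ]′ (convex-centers p q adj s unit)

  Visible : ∀ {a p} → p ∈ pixels P → InPixel a p → Sees P 1# (center p) a
  Visible {a} {p} p∈P a∈p =
    (λ s unit → lose p∈P (InPixel-convex p unit (InPixel-center p) a∈p)) , WithinL₂-center p a∈p

  center⇒Step : ∀ {a p} → p ∈ pixels P → InPixel a p → Step (center p) a
  center⇒Step {a} {p} p∈P a∈p = d₁-center-≤ p a∈p , proj₁ (Visible p∈P a∈p)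

  Step⇒center : ∀ {a p} → p ∈ pixels P → InPixel a p → Step a (center p)
  Step⇒center {a} {p} p∈P a∈p =
    ≤-trans (d₁-sym-≤ a (center p)) (d₁-center-≤ p a∈p) ,
    λ s unit → lose p∈P (InPixel-convex p unit a∈p (InPixel-center p))

  centers : List Point
  centers = map center (distinctPixels P)

  -- The 2 pays for the step from `a` to the centre of a pixel containing it and for the step back.
  center-walk : ∀ {a} → a ∈ᴾ P → ∃[ n ] Σ[ w ∈ Walk Step a a n ]
    n ℕ.≤ 2 ℕ.+ (area P ℕ.+ area P) × (∀ {p} → p ∈ pixels P → Visits (center p) w)
  center-walk a∈P with find a∈P
  ... | p , p∈P , a∈p
    with spanning-walk (distinctPixels P) p∈P (All.tabulate (∈-distinctPixels⁻ P)) (∈-distinctPixels⁺ P)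
  ... | n , w , n≤ , all =
    2 ℕ.+ n , Step⇒center p∈P a∈p ∷ snoc (map-walk Edge⇒Step w) (center⇒Step p∈P a∈p) ,
    ℕ.+-monoʳ-≤ 2 n≤ ,
    λ q∈P → there (snoc-visits (center⇒Step p∈P a∈p) (map-visits Edge⇒Step (all q∈P)))

  -- The 3 consists of the two connecting steps and the extra unit in `duration`. An arbitrary base
  -- point `a` lets the cases with and without prescribed start share one construction.
  CenterSolution : Point → Set
  CenterSolution a = Σ[ T ∈ Solution ]
    length (scans T) ≡ area P ×
    tourLength (tour T) ≤ fromℕ (3 ℕ.+ (area P ℕ.+ area P)) ×
    (∀ t → UnitInterval t → path (tour T) t ∈ᴾ P) ×
    (∀ q → q ∈ᴾ P → Any (λ p → Sees P 1# p q) (scans T)) ×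
    path (tour T) 0# ≈ₚ a

  module _ {a n} (a∈P : a ∈ᴾ P) (w : Walk Step a a n) (n≤ : n ℕ.≤ 2 ℕ.+ (area P ℕ.+ area P))
           (all : ∀ {p} → p ∈ pixels P → Visits (center p) w) where

    open ClosedWalk w

    solution-along : Solution
    solution-along = record
      { tour     = closed-tour
      ; scans    = centers
      ; distinct = UniqueSetoid.map⁺ (≡.setoid Pixel) pointSetoid center-injective (distinctPixels-unique P)
      ; onTour   = All.map⁺ (All.tabulate λ p∈ → visited-OnTour (all (∈-distinctPixels⁻ P p∈)))
      }

    solution-length : tourLength closed-tour ≤ fromℕ (3 ℕ.+ (area P ℕ.+ area P))
    solution-length = ≤-trans tourLength-≤ (fromℕ-mono-≤ {suc n} {3 ℕ.+ (area P ℕ.+ area P)} (ℕ.s≤s n≤))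

    solution-covers : ∀ q → q ∈ᴾ P → Any (λ p → Sees P 1# p q) centers
    solution-covers q q∈P with find q∈P
    ... | p , p∈P , q∈p = Any.map⁺ (lose (∈-distinctPixels⁺ P p∈P) (Visible p∈P q∈p))

    center-solution-along : CenterSolution a
    center-solution-along = solution-along , List.length-map center (distinctPixels P) , solution-length ,
      closed-tour-inside a∈P , solution-covers , curve-0

  center-solution : ∀ {a} → a ∈ᴾ P → CenterSolution a
  center-solution a∈P = let n , w , n≤ , all = center-walk a∈P in center-solution-along a∈P w n≤ all

  some-point : ∃[ a ] a ∈ᴾ P
  some-point = first (pixels P) (nonempty P)
    where
    first : ∀ ps → ps ≢ [] → ∃[ a ] Any (InPixel a) ps
    first []      ps≢[] = contradiction ≡.refl ps≢[]
    first (p ∷ _) _     = center p , here (InPixel-center p)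

  SpanningTreeSolution : Maybe (GridPointOf P) → Solution → Set
  SpanningTreeSolution start T = Feasible P 1# start T ×
    length (scans T) ≡ area P × tourLength (tour T) ≤ fromℕ (3 ℕ.+ (area P ℕ.+ area P))

  feasible-solution : ∀ start → ∃ (SpanningTreeSolution start)
  feasible-solution nothing = free (center-solution (proj₂ some-point))
    where
    free : ∀ {a} → CenterSolution a → ∃ (SpanningTreeSolution nothing)
    free (T , count , len , inside , covers , _) =
      T , record { inside = inside ; covers = covers ; starts = tt } , count , len
  feasible-solution (just (g , g∈P)) = anchored (center-solution g∈P)
    where
    anchored : CenterSolution (gridPoint g) → ∃ (SpanningTreeSolution (just (g , g∈P)))
    anchored (T , count , len , inside , covers , starts) =
      T , record { inside = inside ; covers = covers ; starts = starts } , count , len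

-- Lower bounds

-- The boundary excess k((2M + 1)² - 4M²) = 4kM + k is at most 5kM, hence less than M². It therefore
-- cannot pay for one more pixel, and integrality removes it entirely.
scan-count-arithmetic : ∀ k N M → 5 ℕ.* k ℕ.< M →
  let side = suc (M ℕ.+ M) in N ℕ.* (M ℕ.* M) ℕ.≤ k ℕ.* (side ℕ.* side) → N ℕ.≤ 4 ℕ.* k
scan-count-arithmetic k N M 5k<M count = ℕ.≮⇒≥ λ 4k<N → ℕ.<-irrefl ≡.refl (begin-strict
  suc (4 ℕ.* k) ℕ.* (M ℕ.* M)                           ≤⟨ ℕ.*-monoˡ-≤ (M ℕ.* M) 4k<N ⟩
  N ℕ.* (M ℕ.* M)                                       ≤⟨ count ⟩
  k ℕ.* (suc (M ℕ.+ M) ℕ.* suc (M ℕ.+ M))               ≡⟨ expand k M ⟩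
  4 ℕ.* k ℕ.* (M ℕ.* M) ℕ.+ (4 ℕ.* k ℕ.* M ℕ.+ k ℕ.* 1) ≤⟨ ℕ.+-monoʳ-≤ (4 ℕ.* k ℕ.* (M ℕ.* M))
                                                             (ℕ.+-monoʳ-≤ (4 ℕ.* k ℕ.* M) (ℕ.*-monoʳ-≤ k 1≤M)) ⟩
  4 ℕ.* k ℕ.* (M ℕ.* M) ℕ.+ (4 ℕ.* k ℕ.* M ℕ.+ k ℕ.* M) ≡⟨ collect k M ⟩
  4 ℕ.* k ℕ.* (M ℕ.* M) ℕ.+ 5 ℕ.* k ℕ.* M               <⟨ ℕ.+-monoʳ-< (4 ℕ.* k ℕ.* (M ℕ.* M))
                                                             (ℕ.*-monoˡ-< M {{ℕ.>-nonZero 1≤M}} 5k<M) ⟩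
  4 ℕ.* k ℕ.* (M ℕ.* M) ℕ.+ M ℕ.* M                     ≡⟨ ℕ.+-comm _ (M ℕ.* M) ⟩
  suc (4 ℕ.* k) ℕ.* (M ℕ.* M)                           ∎)
  where
  open ℕ.≤-Reasoning
  1≤M : 1 ℕ.≤ M
  1≤M = ℕ.≤-trans (ℕ.s≤s ℕ.z≤n) 5k<M
  expand : ∀ k M → k ℕ.* (suc (M ℕ.+ M) ℕ.* suc (M ℕ.+ M)) ≡ 4 ℕ.* k ℕ.* (M ℕ.* M) ℕ.+ (4 ℕ.* k ℕ.* M ℕ.+ k ℕ.* 1)
  expand = ℕ-Solver.solve-∀
  collect : ∀ k M → 4 ℕ.* k ℕ.* (M ℕ.* M) ℕ.+ (4 ℕ.* k ℕ.* M ℕ.+ k ℕ.* M) ≡ 4 ℕ.* k ℕ.* (M ℕ.* M) ℕ.+ 5 ℕ.* k ℕ.* M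
  collect = ℕ-Solver.solve-∀

-- The extra 1 in `side` contributes a whole `D`, which no constant absorbs if the tour is long. For
-- D ≥ M² the claim already follows from N ≤ M; otherwise this `D` costs at most M² and side² at
-- most 9M², whence the 10.
tour-length-arithmetic : ∀ D N M → N ℕ.≤ M → 1 ℕ.≤ M →
  let side = suc (M ℕ.+ M) in N ℕ.* (M ℕ.* M) ℕ.≤ side ℕ.* D ℕ.+ side ℕ.* side →
  N ℕ.* M ℕ.≤ 2 ℕ.* D ℕ.+ 10 ℕ.* M
tour-length-arithmetic D N M N≤M 1≤M count with ℕ.≤-total (M ℕ.* M) D
... | inj₁ M²≤D = begin
  N ℕ.* M                  ≤⟨ ℕ.*-monoˡ-≤ M N≤M ⟩
  M ℕ.* M                  ≤⟨ M²≤D ⟩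
  D                        ≤⟨ ℕ.m≤m+n D _ ⟩
  2 ℕ.* D                  ≤⟨ ℕ.m≤m+n _ _ ⟩
  2 ℕ.* D ℕ.+ 10 ℕ.* M     ∎
  where open ℕ.≤-Reasoning
... | inj₂ D≤M² = ℕ.*-cancelʳ-≤ (N ℕ.* M) (2 ℕ.* D ℕ.+ 10 ℕ.* M) M {{ℕ.>-nonZero 1≤M}} (begin
  N ℕ.* M ℕ.* M                                               ≡⟨ ℕ.*-assoc N M M ⟩
  N ℕ.* (M ℕ.* M)                                             ≤⟨ count ⟩
  suc (M ℕ.+ M) ℕ.* D ℕ.+ suc (M ℕ.+ M) ℕ.* suc (M ℕ.+ M)     ≡⟨ expand D M ⟩
  D ℕ.+ 2 ℕ.* D ℕ.* M ℕ.+ side ℕ.* side                       ≤⟨ ℕ.+-mono-≤ (ℕ.+-monoˡ-≤ (2 ℕ.* D ℕ.* M) D≤M²)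
                                                                   (ℕ.*-mono-≤ side≤3M side≤3M) ⟩
  M ℕ.* M ℕ.+ 2 ℕ.* D ℕ.* M ℕ.+ 3 ℕ.* M ℕ.* (3 ℕ.* M)         ≡⟨ collect D M ⟩
  (2 ℕ.* D ℕ.+ 10 ℕ.* M) ℕ.* M                                ∎)
  where
  open ℕ.≤-Reasoning
  side : ℕ
  side = suc (M ℕ.+ M)
  side≤3M : side ℕ.≤ 3 ℕ.* M
  side≤3M = begin
    1 ℕ.+ (M ℕ.+ M)   ≤⟨ ℕ.+-monoˡ-≤ (M ℕ.+ M) 1≤M ⟩
    M ℕ.+ (M ℕ.+ M)   ≡⟨ triple M ⟩
    3 ℕ.* M           ∎
    where
    triple : ∀ M → M ℕ.+ (M ℕ.+ M) ≡ 3 ℕ.* M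
    triple = ℕ-Solver.solve-∀
  expand : ∀ D M → suc (M ℕ.+ M) ℕ.* D ℕ.+ suc (M ℕ.+ M) ℕ.* suc (M ℕ.+ M) ≡
                   D ℕ.+ 2 ℕ.* D ℕ.* M ℕ.+ suc (M ℕ.+ M) ℕ.* suc (M ℕ.+ M)
  expand = ℕ-Solver.solve-∀
  collect : ∀ D M → M ℕ.* M ℕ.+ 2 ℕ.* D ℕ.* M ℕ.+ 3 ℕ.* M ℕ.* (3 ℕ.* M) ≡ (2 ℕ.* D ℕ.+ 10 ℕ.* M) ℕ.* M
  collect = ℕ-Solver.solve-∀

Any-Pointwise : ∀ {A B : Set} {R : A → B → Set} {Q : A → Set} {S : B → Set} →
                (∀ {x y} → R x y → Q x → S y) →
                ∀ {xs ys} → Pointwise R xs ys → Any Q xs → Any S ys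
Any-Pointwise f (r ∷ rs) (here q)  = here (f r q)
Any-Pointwise f (r ∷ rs) (there a) = there (Any-Pointwise f rs a)

-- Area bounds from covering sets of scan points

module LowerBound (ℝ : CompleteOrderedField) (P : Polyomino) where

  open MWPDV ℝ
  open OrderedField ℝ
  open Solver using (solve; con; _:=_; _:+_; _:*_; _:-_; :-_)

  Close : Carrier → Carrier → Set
  Close x y = (y - x ≤ 1#) × (x - y ≤ 1#)

  -- The unit disc is relaxed to its bounding square, of area 4 instead of π, in exchange for
  -- independent coordinates.
  Near : Point → Point → Set
  Near (x , y) (x′ , y′) = Close x x′ × Close y y′

  Near-respˡ : ∀ {p p′ q} → p ≈ₚ p′ → Near p q → Near p′ q
  Near-respˡ (x≈ , y≈) (cx , cy) = coordinate x≈ cx , coordinate y≈ cy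
    where
    coordinate : ∀ {x x′ y} → x ≈ x′ → Close x y → Close x′ y
    coordinate x≈ (l , h) = ≤-respˡ-≈ (+-congˡ (-‿cong x≈)) l , ≤-respˡ-≈ (+-congʳ x≈) h

  WithinL₂⇒Near : ∀ {p q} → WithinL₂ 1# p q → Near p q
  WithinL₂⇒Near {x , y} {x′ , y′} within =
    close x x′ (≤-trans (≤-respˡ-≈ (+-identityʳ _) (+-mono-≤ ≤-refl (0≤x² (y′ - y)))) within′) ,
    close y y′ (≤-trans (≤-respˡ-≈ (+-identityˡ _) (+-mono-≤ (0≤x² (x′ - x)) ≤-refl)) within′)
    where
    within′ : (x′ - x) * (x′ - x) + (y′ - y) * (y′ - y) ≤ 1#
    within′ = ≤-respʳ-≈ (*-identityˡ 1#) within
    close : ∀ x y → (y - x) * (y - x) ≤ 1# → Close x y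
    close x y d²≤1 = x²≤1⇒x≤1 d²≤1 , x²≤1⇒x≤1 (≤-respˡ-≈
      (solve 2 (λ x y → (y :- x) :* (y :- x) := (x :- y) :* (x :- y)) refl x y) d²≤1)

  module Discretisation (m : ℕ) where

    M : ℕ
    M = suc m

    open Boxes M

    IsFloor : Carrier → ℤ → Set
    IsFloor x u = (fromℤ u ≤ fromℕ M * x) × ¬ (fromℤ u + 1# ≤ fromℕ M * x)

    IsFloorₚ : Point → ℤ × ℤ → Set
    IsFloorₚ (x , y) (u , v) = IsFloor x u × IsFloor y v

    floor : ∀ i {x} → (fromℤ i ≤ x) × (x ≤ fromℤ i + 1#) → ∃ (IsFloor x)
    -- The fuel is M + 1, since on the right side of the pixel M x equals iM + M and is not strictly
    -- below it.
    floor i {x} (i≤x , x≤i+1) = floor-search (i ℤ.* + M) (suc M)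
      (by-difference (0≤fromℕ M ⊗ ≤⇒0≤- i≤x)
        (trans (solve 3 (λ m i x → m :* (x :- i) := m :* x :- i :* m) refl (fromℕ M) (fromℤ i) x)
               (+-congˡ (-‿cong (sym (fromℤ-* i (+ M)))))))
      λ le → 1≰0 (by-difference (≤⇒0≤- le ⊕ 0≤fromℕ M ⊗ ≤⇒0≤- x≤i+1)
        (trans (+-congʳ (+-congˡ (-‿cong (+-congʳ (fromℤ-* i (+ M))))))
          (solve 3 (λ m i x → m :* x :- (i :* m :+ (con (+ 1) :+ m)) :+ m :* (i :+ con (+ 1) :- x)
            := con (+ 0) :- con (+ 1)) refl (fromℕ M) (fromℤ i) x)))

    floors : ∀ {S} → All (_∈ᴾ P) S → ∃ (Pointwise IsFloorₚ S)
    floors [] = [] , []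
    floors (s∈P ∷ S⊆P) with find s∈P
    ... | (i , j) , _ , ix , jy =
      let u , fu = floor i ix ; v , fv = floor j jy ; zs , fs = floors S⊆P
      in (u , v) ∷ zs , (fu , fv) ∷ fs

    fromℤ-sub : ∀ i j → fromℤ (i ℤ.- j) ≈ fromℤ i - fromℤ j
    fromℤ-sub i j = trans (fromℤ-+ i (ℤ.- j)) (+-congˡ (fromℤ-neg j))

    -- Rounding the scan point does not enlarge the square: u ≤ M x gives the lower end, and the
    -- upper end comes out as a < u + M + 1, which is a ≤ u + M for integers. This relies on the
    -- sample point lying exactly on the grid.
    Close⇒≲ : ∀ {x y u a} → IsFloor x u → Close x y → fromℤ a ≈ fromℕ M * y → a ≲ u
    Close⇒≲ {x} {y} {u} {a} (u≤Mx , u+1≰Mx) (y-x≤1 , x-y≤1) a≈My =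
      fromℤ-cancel-≤ (by-difference (0≤fromℕ M ⊗ ≤⇒0≤- x-y≤1 ⊕ ≤⇒0≤- u≤Mx)
        (trans (solve 4 (λ m x y u → m :* (con (+ 1) :- (x :- y)) :+ (m :* x :- u) := m :* y :- (u :- m)) refl
                 (fromℕ M) x y (fromℤ u))
               (+-cong (sym a≈My) (-‿cong (sym (fromℤ-sub u (+ M))))))) ,
      ℤ.≮⇒≥ λ u+M<a → u+1≰Mx (by-difference
        (≤⇒0≤- (fromℤ-mono-≤ (ℤ.i<j⇒suc[i]≤j u+M<a)) ⊕ 0≤fromℕ M ⊗ ≤⇒0≤- y-x≤1)
        (trans (+-congʳ (+-cong a≈My (-‿cong (trans (fromℤ-suc (u ℤ.+ + M)) (+-congʳ (fromℤ-+ u (+ M)))))))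
          (solve 4 (λ m x y u → m :* y :- (u :+ m :+ con (+ 1)) :+ m :* (con (+ 1) :- (y :- x))
            := m :* x :- (u :+ con (+ 1))) refl (fromℕ M) x y (fromℤ u))))

    module _ where
      private
        w : Carrier
        w = proj₁ (fromℕ-inverse m)
        0≤w : 0# ≤ w
        0≤w = proj₁ (proj₂ (fromℕ-inverse m))
        Mw≈1 : fromℕ M * w ≈ 1#
        Mw≈1 = proj₂ (proj₂ (fromℕ-inverse m))

      sample : ℤ → Fin M → Carrier
      sample i p = fromℤ i + fromℕ (toℕ p) * w

      sample-in : ∀ i p → (fromℤ i ≤ sample i p) × (sample i p ≤ fromℤ i + 1#)
      sample-in i p =
        by-difference (0≤fromℕ (toℕ p) ⊗ 0≤w)
          (solve 2 (λ i t → t := i :+ t :- i) refl (fromℤ i) (fromℕ (toℕ p) * w)) ,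
        by-difference (0≤w ⊗ ≤⇒0≤- (fromℕ-mono-≤ (ℕ.<⇒≤ (Fin.toℕ<n p))))
          (trans (solve 4 (λ w m t i → w :* (m :- t) := i :+ m :* w :- (i :+ t :* w)) refl w (fromℕ M) (fromℕ (toℕ p)) (fromℤ i))
                 (+-congʳ (+-congˡ Mw≈1)))

      sample-scaled : ∀ i p → fromℤ (i ℤ.* + M ℤ.+ + toℕ p) ≈ fromℕ M * sample i p
      sample-scaled i p = trans (fromℤ-+ (i ℤ.* + M) (+ toℕ p)) (trans (+-congʳ (fromℤ-* i (+ M)))
        (trans (+-congˡ (trans (sym (*-identityʳ _)) (*-congˡ (sym Mw≈1))))
          (solve 4 (λ i m t w → i :* m :+ t :* (m :* w) := m :* (i :+ t :* w)) refl (fromℤ i) (fromℕ M) (fromℕ (toℕ p)) w)))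

    Near⇒InBox : ∀ i j o {s z} → IsFloorₚ s z → Near s (sample i (proj₁ o) , sample j (proj₂ o)) →
                 InBox z (cell (i , j) o)
    Near⇒InBox i j (p , q) {_} {u , v} (fu , fv) (cx , cy) =
      Close⇒≲ {u = u} fu cx (sample-scaled i p) , Close⇒≲ {u = v} fv cy (sample-scaled j q)

    step-≤ : ∀ {x x′ u u′} → IsFloor x u → IsFloor x′ u′ → fromℕ ℤ.∣ u′ ℤ.- u ∣ ≤ fromℕ M * ∣ x′ - x ∣ + 1#
    step-≤ {x} {x′} {u} {u′} (u≤ , u≰) (u′≤ , u′≰)
      with ℤ.+∣i∣≡i⊎+∣i∣≡-i (u′ ℤ.- u)
         | total (fromℤ u + 1#) (fromℕ M * x) | total (fromℤ u′ + 1#) (fromℕ M * x′)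
    ... | _       | inj₁ le | _       = contradiction le u≰
    ... | _       | _       | inj₁ le = contradiction le u′≰
    ... | inj₁ eq | inj₂ Mx≤u+1 | _ = ≤-respˡ-≈ (reflexive (≡.cong fromℤ (≡.sym eq))) (by-difference
      (≤⇒0≤- u′≤ ⊕ ≤⇒0≤- Mx≤u+1 ⊕ 0≤fromℕ M ⊗ ≤⇒0≤- (x≤∣x∣ (x′ - x)))
      (trans (solve 6 (λ m x x′ u u′ d → m :* x′ :- u′ :+ (u :+ con (+ 1) :- m :* x) :+ m :* (d :- (x′ :- x))
          := m :* d :+ con (+ 1) :- (u′ :- u)) refl (fromℕ M) x x′ (fromℤ u) (fromℤ u′) (∣ x′ - x ∣))
        (+-congˡ (-‿cong (sym (fromℤ-sub u′ u))))))
    ... | inj₂ eq | _ | inj₂ Mx′≤u′+1 = ≤-respˡ-≈ (reflexive (≡.cong fromℤ (≡.sym eq))) (by-difference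
      (≤⇒0≤- u≤ ⊕ ≤⇒0≤- Mx′≤u′+1 ⊕ 0≤fromℕ M ⊗ ≤⇒0≤- (-x≤∣x∣ (x′ - x)))
      (trans (solve 6 (λ m x x′ u u′ d → m :* x :- u :+ (u′ :+ con (+ 1) :- m :* x′) :+ m :* (d :- (:- (x′ :- x)))
          := m :* d :+ con (+ 1) :- (:- (u′ :- u))) refl (fromℕ M) x x′ (fromℤ u) (fromℤ u′) (∣ x′ - x ∣))
        (+-congˡ (-‿cong (sym (trans (fromℤ-neg (u′ ℤ.- u)) (-‿cong (fromℤ-sub u′ u))))))))

    -- Taking floors at both ends changes a coordinate difference by at most 1, so two coordinates
    -- cost 2 per side of the polygon.
    gridLength-≤ : ∀ {S zs} → Pointwise IsFloorₚ S zs →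
                   fromℕ (gridLength zs) ≤ fromℕ M * polylineLength S + fromℕ 2 * fromℕ (length S)
    gridLength-≤ [] = ≤-reflexive (solve 1 (λ m → con (+ 0) := m :* con (+ 0) :+ con (+ 2) :* con (+ 0)) refl (fromℕ M))
    gridLength-≤ {s ∷ []} (_ ∷ []) = by-difference 0≤1+1
      (solve 1 (λ m → con (+ 1) :+ con (+ 1) := m :* con (+ 0) :+ con (+ 2) :* (con (+ 1) :+ con (+ 0)) :- con (+ 0)) refl (fromℕ M))
      where
      0≤1+1 : 0# ≤ 1# + 1#
      0≤1+1 = 0≤1 ⊕ 0≤1
    gridLength-≤ {(x , y) ∷ (x′ , y′) ∷ S} {(u , v) ∷ (u′ , v′) ∷ zs} ((fu , fv) ∷ (fu′ , fv′) ∷ fs) =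
      by-difference (≤⇒0≤- (step-≤ {u = u} {u′} fu fu′) ⊕ ≤⇒0≤- (step-≤ {u = v} {v′} fv fv′)
                     ⊕ ≤⇒0≤- (gridLength-≤ ((fu′ , fv′) ∷ fs)))
        (trans (solve 8 (λ m dx dy l k a b c →
            m :* dx :+ con (+ 1) :- a :+ (m :* dy :+ con (+ 1) :- b) :+ (m :* l :+ con (+ 2) :* k :- c)
            := m :* (dx :+ dy :+ l) :+ con (+ 2) :* (con (+ 1) :+ k) :- (a :+ b :+ c)) refl
            (fromℕ M) (∣ x′ - x ∣) (∣ y′ - y ∣) (polylineLength ((x′ , y′) ∷ S)) (fromℕ (length ((x′ , y′) ∷ S)))
            (fromℕ a) (fromℕ b) (fromℕ c))
          (+-congˡ (-‿cong (trans (+-congʳ (sym (fromℕ-+ a b))) (sym (fromℕ-+ (a ℕ.+ b) c))))))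
      where
      a b c : ℕ
      a = ℤ.∣ u′ ℤ.- u ∣
      b = ℤ.∣ v′ ℤ.- v ∣
      c = gridLength ((u′ , v′) ∷ zs)

  module _ {S : List Point} (S⊆P : All (_∈ᴾ P) S) (near : ∀ q → q ∈ᴾ P → Any (λ s → Near s q) S) where

    private
      k N : ℕ
      k = length S
      N = area P

      -- Fine enough that the rounding errors, one per scan point, are negligible.
      open Discretisation (5 ℕ.* k ℕ.+ N)
      open Boxes M

      covers : ∀ {zs} → Pointwise IsFloorₚ S zs → Covers zs (distinctPixels P)
      covers fs {i , j} p∈ o = Any-Pointwise (λ {s} {z} → Near⇒InBox i j o {s} {z}) fs
        (near (sample i (proj₁ o) , sample j (proj₂ o))
          (lose (∈-distinctPixels⁻ P p∈) (sample-in i (proj₁ o) , sample-in j (proj₂ o))))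

      5k<M : 5 ℕ.* k ℕ.< M
      5k<M = ℕ.s≤s (ℕ.m≤m+n (5 ℕ.* k) N)

      N≤M : N ℕ.≤ M
      N≤M = ℕ.≤-trans (ℕ.m≤n+m N (5 ℕ.* k)) (ℕ.n≤1+n _)

      k≤M : k ℕ.≤ M
      k≤M = ℕ.≤-trans (ℕ.m≤n*m k 5) (ℕ.<⇒≤ 5k<M)

    area-≤-scans : N ℕ.≤ 4 ℕ.* k
    area-≤-scans with floors S⊆P
    ... | zs , fs = scan-count-arithmetic k N M 5k<M
      (≡.subst (λ n → N ℕ.* (M ℕ.* M) ℕ.≤ n ℕ.* (side ℕ.* side)) (≡.sym (Pointwise.Pointwise-length fs))
        (length-covered-≤-boxes (distinctPixels-unique P) (covers fs)))

    private
      gridLength-bound : ∀ {zs} → Pointwise IsFloorₚ S zs → N ℕ.* M ℕ.≤ 2 ℕ.* gridLength zs ℕ.+ 10 ℕ.* M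
      -- A polyomino has a point, and an empty list of stops leaves it uncovered.
      gridLength-bound {[]} [] = contradiction (near _ (proj₂ (CenterTour.some-point ℝ P))) λ ()
      gridLength-bound {z ∷ zs} fs = tour-length-arithmetic (gridLength (z ∷ zs)) N M N≤M (ℕ.s≤s ℕ.z≤n)
        (length-covered-≤-sweep (distinctPixels-unique P) (covers fs))

    -- After division by `M`, the constant is the 10 of `tour-length-arithmetic` plus 4: twice the
    -- rounding error 2k is 4k, and k ≤ M.
    area-≤-length : fromℕ N ≤ fromℕ 2 * polylineLength S + fromℕ 14
    area-≤-length with floors S⊆P
    ... | zs , fs = fromℕ-*-cancel-≤ (5 ℕ.* k ℕ.+ N) (by-difference
      (≤⇒0≤- real-bound ⊕ 0≤fromℕ 2 ⊗ ≤⇒0≤- (gridLength-≤ fs) ⊕ 0≤fromℕ 4 ⊗ ≤⇒0≤- (fromℕ-mono-≤ k≤M))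
      (solve 5 (λ m n d l k → con (+ 2) :* d :+ con (+ 10) :* m :- n :* m
          :+ con (+ 2) :* (m :* l :+ con (+ 2) :* k :- d) :+ con (+ 4) :* (m :- k)
          := m :* (con (+ 2) :* l :+ con (+ 14)) :- m :* n) refl
        (fromℕ M) (fromℕ N) (fromℕ (gridLength zs)) (polylineLength S) (fromℕ k)))
      where
      real-bound : fromℕ N * fromℕ M ≤ fromℕ 2 * fromℕ (gridLength zs) + fromℕ 10 * fromℕ M
      real-bound = ≤-respˡ-≈ (fromℕ-* N M) (≤-respʳ-≈
        (trans (fromℕ-+ (2 ℕ.* gridLength zs) (10 ℕ.* M)) (+-cong (fromℕ-* 2 (gridLength zs)) (fromℕ-* 10 M)))
        (fromℕ-mono-≤ (gridLength-bound fs)))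

  module _ (T : Tour) where

    -- Scan points equal points of the curve only up to `≈ₚ`. Coverage is moved to the curve points
    -- in the relaxed form `Near`, which respects that equality.
    times : ∀ {xs} → All (_OnTour T) xs → ∃[ ts ] length ts ≡ length xs × All UnitInterval ts ×
      (∀ {q} → Any (λ p → Near p q) xs → Any (λ t → Near (path T t) q) ts)
    times [] = [] , ≡.refl , [] , λ ()
    times {x ∷ _} ((t , unit , at-t) ∷ on) with times on
    ... | ts , count , units , transfer = t ∷ ts , ≡.cong suc count , unit ∷ units ,
      λ { (here n)  → here (Near-respˡ {x} {path T t} (Setoid.sym pointSetoid at-t) n)
        ; (there a) → there (transfer a) }

  -- The scan points are listed in no particular order. Sorting their times makes them the vertices
  -- of an inscribed polygon, so its length is at most the supremum that defines `tourLength`.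
  lower-bounds : ∀ {start} T → Feasible P 1# start T →
    (fromℕ (area P) ≤ fromℕ 4 * fromℕ (length (scans T))) ×
    (fromℕ (area P) ≤ fromℕ 2 * tourLength (tour T) + fromℕ 14)
  lower-bounds T feasible with times (tour T) (onTour T)
  ... | ts , count , units , transfer =
    ≤-respʳ-≈ (fromℕ-* 4 (length (scans T))) (fromℕ-mono-≤ (≡.subst (λ k → area P ℕ.≤ 4 ℕ.* k) count′
      (area-≤-scans inside near))) ,
    ≤-trans (area-≤-length inside near) (by-difference (0≤fromℕ 2 ⊗ ≤⇒0≤- polyline-≤)
      (solve 2 (λ l L → con (+ 2) :* (L :- l) := con (+ 2) :* L :+ con (+ 14) :- (con (+ 2) :* l :+ con (+ 14))) refl
        (polylineLength stops) (tourLength (tour T))))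
    where
    open Sort decTotalOrder using (sort; sort-↭; sort-↗)
    sorted-units : All UnitInterval (sort ts)
    sorted-units = All-resp-↭ (↭-sym (sort-↭ ts)) units
    stops : List Point
    stops = map (path (tour T)) (sort ts)
    count′ : length stops ≡ length (scans T)
    count′ = ≡.trans (List.length-map _ (sort ts)) (≡.trans (↭-length (sort-↭ ts)) count)
    inside : All (_∈ᴾ P) stops
    inside = All.map⁺ (All.map (λ {t} unit → Feasible.inside feasible t unit) sorted-units)
    near : ∀ q → q ∈ᴾ P → Any (λ s → Near s q) stops
    near q q∈P = Any.map⁺ (Any-resp-↭ (↭-sym (sort-↭ ts))
      (transfer (Any.map (λ {p} (_ , within) → WithinL₂⇒Near {p} {q} within) (Feasible.covers feasible q q∈P))))
    polyline-≤ : polylineLength stops ≤ tourLength (tour T)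
    polyline-≤ = proj₁ (isLength (tour T)) (sort ts , (sort-↗ ts , sorted-units) , refl)

-- Combining the upper and lower bounds

module Competitive (ℝ : CompleteOrderedField) where

  open MWPDV ℝ
  open OrderedField ℝ
  open Solver using (solve; con; _:=_; _:+_; _:*_; _:-_; :-_)

  -- With N = `area P`, the scan cost c N is at most 4c times the number of scans of `T*`, and the
  -- length is at most 3 + 2N ≤ 3 + 2(2L + 14) for the length L of `T*`. Hence 31 = 3 + 28.
  competitive : ∀ P {c start} → 0# ≤ c → ∀ T → length (scans T) ≡ area P →
    tourLength (tour T) ≤ fromℕ (3 ℕ.+ (area P ℕ.+ area P)) →
    ∀ T* → Feasible P 1# start T* → cost c T ≤ fromℕ 4 * cost c T* + fromℕ 31
  competitive P {c} 0≤c T count len T* feasible =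
    by-difference
      (0≤c ⊗ ≤⇒0≤- (≤-respˡ-≈ (reflexive (≡.cong fromℕ (≡.sym count))) (proj₁ bounds))
        ⊕ 0≤fromℕ 2 ⊗ ≤⇒0≤- (proj₂ bounds) ⊕ ≤⇒0≤- len′)
      (solve 6 (λ c k l n L k* →
          c :* (con (+ 4) :* k* :- k) :+ con (+ 2) :* (con (+ 2) :* L :+ con (+ 14) :- n)
            :+ (con (+ 3) :+ (n :+ n) :- l)
          := con (+ 4) :* (c :* k* :+ L) :+ con (+ 31) :- (c :* k :+ l)) refl
        c (fromℕ (length (scans T))) (tourLength (tour T)) (fromℕ (area P)) (tourLength (tour T*))
        (fromℕ (length (scans T*))))
    where
    bounds : (fromℕ (area P) ≤ fromℕ 4 * fromℕ (length (scans T*))) ×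
             (fromℕ (area P) ≤ fromℕ 2 * tourLength (tour T*) + fromℕ 14)
    bounds = LowerBound.lower-bounds ℝ P T* feasible
    len′ : tourLength (tour T) ≤ fromℕ 3 + (fromℕ (area P) + fromℕ (area P))
    len′ = ≤-respʳ-≈ (trans (fromℕ-+ 3 (area P ℕ.+ area P)) (+-congˡ (fromℕ-+ (area P) (area P)))) len

theorem9 : (ℝ : CompleteOrderedField) → let open MWPDV ℝ in
    ∃[ β ] (0# ≤ β) ×
    ((P : Polyomino) (c : Carrier) → 0# ≤ c → (start : Maybe (GridPointOf P)) →
    ∃[ T ] Feasible P 1# start T ×
    (∀ T* → Optimal P 1# c start T* →
    cost c T ≤ fromℕ 4 * cost c T* + β))
theorem9 ℝ = fromℕ 31 , 0≤fromℕ 31 , λ P c 0≤c start →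
  let T , feasible , count , len = CenterTour.feasible-solution ℝ P start in
  T , feasible , λ T* (feasible* , _) → competitive P 0≤c T count len T* feasible*
  where
  open MWPDV ℝ
  open OrderedField ℝ
  open Competitive ℝ
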